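{- Let $b\ge1$ and let $\alpha_1,\dots,\alpha_b$ be primitive sequences. For each $j$, if $\alpha_j=(t_1,\dots,t_{\ell-1})$, let $V_j=\{2,\,2(1+t_1),\,\dots,\,2(1+t_1+\cdots+t_{\ell-1})\}$. Let $k_1,\dots,k_b$ be integers with $k_1\ge -1$ and $k_{j+1}\ge \max(V_j+k_j)-1$ for $1\le j\le b-1$, where $W+k=\{w+k: w\in W\}$, and let $V=(V_1+k_1)\cup\cdots\cup(V_b+k_b)$. Then the sequence $H(D^{(m,V)})$ of Hankel determinants is periodic for every integer $m\ge\max(V)$.
   Context: For an integer $m\ge 2$ and $V\subseteq[m]=\{1,\dots,m\}$, let $(m,V)=\{k\in\mathbb{Z}^+ : k\equiv j \pmod m \text{ for some } j\in V\}$. A Dyck path of size $n$ is a lattice path from $(0,0)$ to $(2n,0)$ with steps $(1,1)$ and $(1,-1)$ never going below the $x$-axis; a peak is an up-step immediately followed by a down-step, and its height is the $y$-coordinate of the point between them. Let $d_n^{(m,V)}$ be the number of Dyck paths of size $n$ none of whose peaks has height in $(m,V)$, and $D^{(m,V)}(x)=\sum_{n\ge0}d_n^{(m,V)}x^n$. For a power series $F=\sum f_nx^n$ and $n\ge1$, $H_n(F)=\det(f_{i+j})_{0\le i,j\le n-1}$ and $H(F)=(H_1(F),H_2(F),\dots)$. For positive integers $t_1,t_2,\dots$ define rationals $h(t_1)=2-t_1$ and $h(t_1,\dots,t_j)=2-t_j-1/h(t_1,\dots,t_{j-1})$ for $j\ge2$. A sequence $(t_1,\dots,t_b)$ ($b\ge0$)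 of positive integers is admissible if $h(t_1),\dots,h(t_1,\dots,t_b)$ are all nonzero (the empty sequence is admissible). A sequence $(t_1,\dots,t_{b+1})$ of positive integers is primitive if $(t_1,\dots,t_b)$ is admissible and $h(t_1,\dots,t_{b+1})=0$. -}

module Defs where

open import Data.Bool using (Bool; true; false; not; _∧_)
open import Data.Nat as ℕ using (ℕ; zero; suc)
open import Data.Integer as ℤ using (ℤ; +_; -[1+_])
open import Data.Integer.Divisibility.Signed using (_∣?_)
open import Data.Rational as ℚ using (ℚ; 0ℚ; 1/_; ≢-nonZero)
open import Data.Fin using (Fin; zero; suc; toℕ; punchIn)
open import Data.Bool.ListAction using (any)
open import Data.List using (List; []; _∷_; map; scanl; length; filterᵇ; concatMap; allFin)
open import Data.List.Relation.Unary.All using (All)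
open import Relation.Nullary.Decidable using (⌊_⌋)
open import Relation.Binary.PropositionalEquality using (_≡_; _≢_)
open import Data.Product using (Σ; _×_)

ℕtoℚ : ℕ → ℚ
ℕtoℚ n = ℚ._/_ (+ n) 1

-- PrimFrom q ts : q is the current value h(t₁,…,t_j) (where t_j is the last
-- consumed entry) and ts = (t_{j+1},…,t_{b+1}) is the rest.  It holds iff
-- every h-value strictly before the last one is nonzero and the last h-value
-- is zero.  The recursion h(…,t) = 2 - t - 1/h(…) is used only when the
-- previous h-value is nonzero.
data PrimFrom (q : ℚ) : List ℕ → Set where
  stop : q ≡ 0ℚ → PrimFrom q []
  step : ∀ {t ts} (nz : q ≢ 0ℚ) →
         PrimFrom (ℚ._-_ (ℚ._-_ (ℕtoℚ 2) (ℕtoℚ t)) (1/_ q {{≢-nonZero nz}})) ts →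
         PrimFrom q (t ∷ ts)

data Primitive : List ℕ → Set where
  prim : ∀ {t ts} → All (ℕ._≤_ 1) (t ∷ ts) →
         PrimFrom (ℚ._-_ (ℕtoℚ 2) (ℕtoℚ t)) ts → Primitive (t ∷ ts)

Vset : List ℕ → List ℕ
Vset ts = map (λ s → 2 ℕ.* (1 ℕ.+ s)) (scanl ℕ._+_ 0 ts)

shift : ℤ → List ℕ → List ℤ
shift k W = map (λ w → + w ℤ.+ k) W

bigV : (b : ℕ) → (Fin b → List ℕ) → (Fin b → ℤ) → List ℤ
bigV b αs ks = concatMap (λ j → shift (ks j) (Vset (αs j))) (allFin b)

data Step : Set where
  U D : Step

inMV : ℕ → List ℤ → ℕ → Bool
inMV m V h = any (λ j → ⌊ (+ m) ∣? (+ h ℤ.- j) ⌋) V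

validDyck : (ℕ → Bool) → ℕ → List Step → Bool
validDyck bad h       []           = ⌊ h ℕ.≟ 0 ⌋
validDyck bad h       (U ∷ D ∷ s)  = not (bad (suc h)) ∧ validDyck bad h s
validDyck bad h       (U ∷ s)      = validDyck bad (suc h) s
validDyck bad zero    (D ∷ s)      = false
validDyck bad (suc h) (D ∷ s)      = validDyck bad h s

words : ℕ → List (List Step)
words zero    = [] ∷ []
words (suc n) = concatMap (λ w → (U ∷ w) ∷ (D ∷ w) ∷ []) (words n)

-- d_n^{(m,V)}: number of Dyck paths of size n (length 2n) with no peak
-- height in (m,V); these are the coefficients of D^{(m,V)}(x).
dyckCount : ℕ → List ℤ → ℕ → ℕ
dyckCount m V n = length (filterᵇ (validDyck (inMV m V) 0) (words (2 ℕ.* n)))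

sumFin : (n : ℕ) → (Fin n → ℤ) → ℤ
sumFin zero    f = + 0
sumFin (suc n) f = f zero ℤ.+ sumFin n (λ i → f (suc i))

sign : ℕ → ℤ
sign zero          = + 1
sign (suc zero)    = -[1+ 0 ]
sign (suc (suc n)) = sign n

det : (n : ℕ) → (Fin n → Fin n → ℤ) → ℤ
det zero    M = + 1
det (suc n) M =
  sumFin (suc n) (λ j → sign (toℕ j) ℤ.* M zero j ℤ.*
                        det n (λ i k → M (suc i) (punchIn j k)))

hankel : (ℕ → ℤ) → ℕ → ℤ
hankel f n = det n (λ i j → f (toℕ i ℕ.+ toℕ j))

Periodic : (ℕ → ℤ) → Set
Periodic H = Σ ℕ λ p → (1 ℕ.≤ p) × ((n : ℕ) → 1 ℕ.≤ n → H (n ℕ.+ p) ≡ H n)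

{-# OPTIONS --safe #-}
module Submission where

-- Let f h be the series of Dyck paths that start from height h and stay above it,
-- with the peak restriction read off at absolute heights, so that
-- f h = 1 / (1 - x (f (h + 1) - ε)) with ε = 1 if the height h + 1 is forbidden and ε = 0 if not.
-- For f = 1 / (1 - x u), the Hankel matrix of (f - 1) / x is L H(u) Lᵀ, and that of f is
-- L diag(1 , H((u - u₀) / x)) Lᵀ, where L is the unitriangular Toeplitz matrix of f.
-- Passing from height h to h + 1 thus turns Hankel determinants of f h into once shifted ones of
-- f (h + 1) and conversely, as long as no height is forbidden. A shifted determinant at the
-- start of a block becomes a determinant of f - 1; two levels further up it is one of f - c for
-- another rational c, and c = p / (p - r) where p / r follows the recursion for h(t₁,…,t_j).
-- A primitive sequence brings p / r, hence c, to 0, and since (p , r) stays coprime only a sign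
-- remains. After m levels the series are the initial ones again.

open import Defs
open import Data.Bool using (Bool; true; false; not; _∧_; _∨_)
open import Data.Bool.ListAction using (any)
open import Data.Nat as ℕ using (ℕ; zero; suc; z≤n; s≤s)
open import Data.Nat.Divisibility as ℕD using ()
open import Data.Nat.ListAction using (sum)
open import Data.Nat.Properties as ℕP using ()
open import Data.Integer as ℤ using (ℤ; +_; -[1+_]; _+_; _*_; -_)
open import Data.Integer.Divisibility.Signed using (_∣_; _∣?_; divides; ∣⇒∣ᵤ; ∣-refl; ∣m∣n⇒∣m+n; ∣m+n∣m⇒∣n)
open import Data.Integer.Properties as ℤP using (*-identityˡ; *-zeroʳ; +-identityʳ; +-identityˡ)
open import Data.Integer.Tactic.RingSolver using (solve-∀)
open import Data.Rational as ℚ using (ℚ; 0ℚ; 1/_; ≢-nonZero)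
open import Data.Rational.Properties as ℚP using ()
open import Data.Rational.Unnormalised as ℚᵘ using (mkℚᵘ; *≡*)
open import Data.Rational.Unnormalised.Properties as ℚᵘP using ()
open import Data.Fin using (Fin; zero; suc; toℕ; punchIn; inject₁)
open import Data.Fin.Properties using (toℕ-inject₁)
open import Data.List using (List; []; _∷_; _++_; map; scanl; length; filterᵇ; concat; concatMap)
open import Data.List.Membership.Propositional using (_∈_)
open import Data.List.Membership.Propositional.Properties using (∈-map⁺; ∈-map⁻)
open import Data.List.Properties using (map-tabulate; map-++)
open import Data.List.Relation.Unary.All as All using (All; []; _∷_)
open import Data.List.Relation.Unary.All.Properties as AllP using (++⁺)
open import Data.List.Relation.Unary.Any using (here; there)
open import Data.Product using (Σ; _×_; _,_; proj₁; proj₂)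
open import Data.Sum using (inj₁; inj₂)
open import Data.Unit using (⊤; tt)
open import Data.Empty using (⊥-elim)
open import Function using (_∘_)
open import Relation.Nullary using (yes; no)
open import Relation.Nullary.Decidable using (⌊_⌋)
open import Relation.Binary.PropositionalEquality using (_≡_; _≢_; refl; sym; trans; cong; cong₂; subst; module ≡-Reasoning)
open ≡-Reasoning

-- Determinants

sumFin-cong : ∀ n {f g : Fin n → ℤ} → (∀ i → f i ≡ g i) → sumFin n f ≡ sumFin n g
sumFin-cong zero    e = refl
sumFin-cong (suc n) e = cong₂ _+_ (e zero) (sumFin-cong n (e ∘ suc))

sumFin-zero : ∀ n {f : Fin n → ℤ} → (∀ i → f i ≡ + 0) → sumFin n f ≡ + 0
sumFin-zero zero    e = refl
sumFin-zero (suc n) e = cong₂ _+_ (e zero) (sumFin-zero n (e ∘ suc))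

sumFin-+ : ∀ n (f g : Fin n → ℤ) → sumFin n (λ i → f i + g i) ≡ sumFin n f + sumFin n g
sumFin-+ zero    f g = refl
sumFin-+ (suc n) f g = trans (cong (λ z → f zero + g zero + z) (sumFin-+ n (f ∘ suc) (g ∘ suc)))
  (interchange (f zero) (g zero) (sumFin n (f ∘ suc)) (sumFin n (g ∘ suc)))
  where
  interchange : ∀ a b c d → a + b + (c + d) ≡ a + c + (b + d)
  interchange = solve-∀

sumFin-*ˡ : ∀ n c (f : Fin n → ℤ) → sumFin n (λ i → c * f i) ≡ c * sumFin n f
sumFin-*ˡ zero    c f = sym (*-zeroʳ c)
sumFin-*ˡ (suc n) c f = trans (cong (λ z → c * f zero + z) (sumFin-*ˡ n c (f ∘ suc)))
  (sym (ℤP.*-distribˡ-+ c (f zero) _))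

sumFin-linear : ∀ n c (f g : Fin n → ℤ) →
  sumFin n (λ i → f i + c * g i) ≡ sumFin n f + c * sumFin n g
sumFin-linear n c f g = trans (sumFin-+ n f (λ i → c * g i)) (cong (λ z → sumFin n f + z) (sumFin-*ˡ n c g))

sumFin-swap : ∀ n m (f : Fin n → Fin m → ℤ) →
  sumFin n (λ i → sumFin m (f i)) ≡ sumFin m (λ j → sumFin n (λ i → f i j))
sumFin-swap zero    m f = sym (sumFin-zero m λ _ → refl)
sumFin-swap (suc n) m f = trans (cong (λ z → sumFin m (f zero) + z) (sumFin-swap n m (f ∘ suc)))
  (sym (sumFin-+ m (f zero) _))

det-cong : ∀ n {M N : Fin n → Fin n → ℤ} → (∀ i j → M i j ≡ N i j) → det n M ≡ det n N
det-cong zero    e = refl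
det-cong (suc n) e = sumFin-cong (suc n) λ j →
  cong₂ _*_ (cong (sign (toℕ j) *_) (e zero j)) (det-cong n λ i k → e (suc i) (punchIn j k))

sign-suc : ∀ n → sign (suc n) ≡ - sign n
sign-suc zero          = refl
sign-suc (suc zero)    = refl
sign-suc (suc (suc n)) = sign-suc n

-- Expanding the minors along their first columns shows that the Laplace
-- expansion along the first row is symmetric under transposition.
det-transpose : ∀ n (M : Fin n → Fin n → ℤ) → det n M ≡ det n (λ i j → M j i)
det-transpose zero          M = refl
det-transpose (suc zero)    M = refl
det-transpose (suc (suc n)) M = cong₂ _+_
  (cong (λ z → + 1 * M zero zero * z) (det-transpose (suc n) λ i j → M (suc i) (suc j)))
  (begin
    sumFin (suc n) (λ j → sign (suc (toℕ j)) * M zero (suc j) *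
      det (suc n) (λ i k → M (suc i) (punchIn (suc j) k)))
  ≡⟨ sumFin-cong (suc n) (λ j → trans
       (cong (λ z → sign (suc (toℕ j)) * M zero (suc j) * z)
         (det-transpose (suc n) λ i k → M (suc i) (punchIn (suc j) k)))
       (sym (sumFin-*ˡ (suc n) (sign (suc (toℕ j)) * M zero (suc j)) (cofactors j)))) ⟩
    sumFin (suc n) (λ j → sumFin (suc n) (λ i → sign (suc (toℕ j)) * M zero (suc j) *
      (sign (toℕ i) * M (suc i) zero * minor i j)))
  ≡⟨ sumFin-swap (suc n) (suc n) (λ j i → sign (suc (toℕ j)) * M zero (suc j) * cofactors j i) ⟩
    sumFin (suc n) (λ i → sumFin (suc n) (λ j → sign (suc (toℕ j)) * M zero (suc j) *
      (sign (toℕ i) * M (suc i) zero * minor i j)))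
  ≡⟨ sumFin-cong (suc n) (λ i → sumFin-cong (suc n) λ j → exchange i j) ⟩
    sumFin (suc n) (λ i → sumFin (suc n) (λ j → sign (suc (toℕ i)) * M (suc i) zero *
      (sign (toℕ j) * M zero (suc j) * minorᵀ j i)))
  ≡⟨ sumFin-cong (suc n) (λ i → trans
       (sumFin-*ˡ (suc n) (sign (suc (toℕ i)) * M (suc i) zero) (λ j → sign (toℕ j) * M zero (suc j) * minorᵀ j i))
       (cong (λ z → sign (suc (toℕ i)) * M (suc i) zero * z)
         (sym (det-transpose (suc n) λ j k → M (punchIn (suc i) k) (suc j))))) ⟩
    sumFin (suc n) (λ i → sign (suc (toℕ i)) * M (suc i) zero *
      det (suc n) (λ j k → M (punchIn (suc i) k) (suc j)))
  ∎)
  where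
  minor minorᵀ : Fin (suc n) → Fin (suc n) → ℤ
  minor i j = det n (λ k l → M (suc (punchIn i l)) (suc (punchIn j k)))
  minorᵀ j i = det n (λ k l → M (suc (punchIn i k)) (suc (punchIn j l)))

  cofactors : Fin (suc n) → Fin (suc n) → ℤ
  cofactors j i = sign (toℕ i) * M (suc i) zero * minor i j

  rearrange : ∀ s t a b m → - s * a * (t * b * m) ≡ - t * b * (s * a * m)
  rearrange = solve-∀

  exchange : ∀ i j →
    sign (suc (toℕ j)) * M zero (suc j) * (sign (toℕ i) * M (suc i) zero * minor i j) ≡
    sign (suc (toℕ i)) * M (suc i) zero * (sign (toℕ j) * M zero (suc j) * minorᵀ j i)
  exchange i j
    rewrite sign-suc (toℕ j) | sign-suc (toℕ i)
          | det-transpose n (λ k l → M (suc (punchIn i l)) (suc (punchIn j k)))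
    = rearrange (sign (toℕ j)) (sign (toℕ i)) (M zero (suc j)) (M (suc i) zero) (minorᵀ j i)

-- Alternating functions of the rows of a matrix

Row : Set
Row = ℕ → ℤ

Matrix : Set
Matrix = ℕ → Row

infix 4 _≈_
_≈_ : Matrix → Matrix → Set
M ≈ N = ∀ i j → M i j ≡ N i j

infixr 5 _◂_
_◂_ : Row → Matrix → Matrix
(x ◂ M) zero    = x
(x ◂ M) (suc i) = M i

◂-congʳ : ∀ x {M N} → M ≈ N → x ◂ M ≈ x ◂ N
◂-congʳ x e zero    j = refl
◂-congʳ x e (suc i) j = e i j

◂-η : ∀ M → M ≈ M zero ◂ (M ∘ suc)
◂-η M zero    j = refl
◂-η M (suc i) j = refl

infixl 6 _⊕_·_
_⊕_·_ : Row → ℤ → Row → Row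
(x ⊕ c · y) j = x j + c * y j

RepeatedFirstRow : ℕ → (Matrix → ℤ) → Set
RepeatedFirstRow zero    F = ⊤
RepeatedFirstRow (suc n) F = ∀ x M → F (x ◂ x ◂ M) ≡ + 0

-- Multilinear and alternating in the first `n` rows and independent of all later ones. The
-- recursion fixes the first row and puts the remaining conditions on the matrix below it; since
-- matrices are infinite, no index type changes on the way.
Alternating : ℕ → (Matrix → ℤ) → Set
Alternating zero    F = ∀ M N → F M ≡ F N
Alternating (suc n) F =
  (∀ x c y M → F (x ⊕ c · y ◂ M) ≡ F (x ◂ M) + c * F (y ◂ M)) ×
  (∀ x → Alternating n (λ M → F (x ◂ M))) ×
  RepeatedFirstRow n F

-- Matrices are functions that are compared entry by entry only, so respecting `_≈_` is a condition
-- of its own.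
Extensional : (Matrix → ℤ) → Set
Extensional F = ∀ {M N} → M ≈ N → F M ≡ F N

0+c*0≡0 : ∀ c → + 0 + c * + 0 ≡ + 0
0+c*0≡0 = solve-∀

alternating-zero : ∀ n → Alternating n (λ _ → + 0)
alternating-zero zero          M N = refl
alternating-zero (suc zero)    = (λ x c y M → sym (0+c*0≡0 c)) , (λ x → alternating-zero zero) , tt
alternating-zero (suc (suc n)) = (λ x c y M → sym (0+c*0≡0 c)) , (λ x → alternating-zero (suc n)) , (λ x M → refl)

alternating-linear : ∀ n {F G} a → Alternating n F → Alternating n G →
  Alternating n (λ M → a * F M + G M)
alternating-linear zero a alt₁ alt₂ M N = cong₂ (λ u v → a * u + v) (alt₁ M N) (alt₂ M N)
alternating-linear (suc n) {F} {G} a (lin₁ , alt₁ , rep₁) (lin₂ , alt₂ , rep₂) =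
  (λ x c y M → trans (cong₂ (λ u v → a * u + v) (lin₁ x c y M) (lin₂ x c y M)) (regroup a c _ _ _ _)) ,
  (λ x → alternating-linear n a (alt₁ x) (alt₂ x)) ,
  repeated n rep₁ rep₂
  where
  regroup : ∀ a c u v u′ v′ → a * (u + c * v) + (u′ + c * v′) ≡ a * u + u′ + c * (a * v + v′)
  regroup = solve-∀
  repeated : ∀ n → RepeatedFirstRow n F → RepeatedFirstRow n G → RepeatedFirstRow n (λ M → a * F M + G M)
  repeated zero    r₁ r₂     = tt
  repeated (suc n) r₁ r₂ x M rewrite r₁ x M | r₂ x M = trans (+-identityʳ (a * + 0)) (*-zeroʳ a)

alternating-sum : ∀ n m (a : Fin m → ℤ) (F : Fin m → Matrix → ℤ) → (∀ j → Alternating n (F j)) →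
  Alternating n (λ M → sumFin m (λ j → a j * F j M))
alternating-sum n zero    a F alt = alternating-zero n
alternating-sum n (suc m) a F alt =
  alternating-linear n (a zero) (alt zero) (alternating-sum n m (a ∘ suc) (F ∘ suc) (alt ∘ suc))

-- Polarisation: with `x + y` in both of the first two rows the value is 0, and expanding it leaves
-- only the two mixed terms.
alternating-swap : ∀ n {F} → Alternating (suc (suc n)) F → ∀ x y M →
  F (x ◂ y ◂ M) ≡ - F (y ◂ x ◂ M)
alternating-swap n {F} (lin , alt , rep) x y M = solve-for (begin
  F (x ◂ y ◂ M) + F (y ◂ x ◂ M)
    ≡⟨ expand (F (x ◂ y ◂ M)) (F (y ◂ x ◂ M)) ⟩
  + 0 + + 1 * F (x ◂ y ◂ M) + + 1 * (F (y ◂ x ◂ M) + + 1 * + 0)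
    ≡⟨ cong₂ (λ u v → u + + 1 * F (x ◂ y ◂ M) + + 1 * (F (y ◂ x ◂ M) + + 1 * v)) (rep x M) (rep y M) ⟨
  F (x ◂ x ◂ M) + + 1 * F (x ◂ y ◂ M) + + 1 * (F (y ◂ x ◂ M) + + 1 * F (y ◂ y ◂ M))
    ≡⟨ cong₂ (λ u v → u + + 1 * v) (proj₁ (alt x) x (+ 1) y M) (proj₁ (alt y) x (+ 1) y M) ⟨
  F (x ◂ z ◂ M) + + 1 * F (y ◂ z ◂ M)
    ≡⟨ lin x (+ 1) y (z ◂ M) ⟨
  F (z ◂ z ◂ M)
    ≡⟨ rep z M ⟩
  + 0 ∎)
  where
  z = x ⊕ + 1 · y
  expand : ∀ u v → u + v ≡ + 0 + + 1 * u + + 1 * (v + + 1 * + 0)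
  expand = solve-∀
  cancel : ∀ u v → u ≡ u + v + - v
  cancel = solve-∀
  solve-for : ∀ {u v} → u + v ≡ + 0 → u ≡ - v
  solve-for {u} {v} e = trans (cancel u v) (trans (cong (_+ - v) e) (+-identityˡ (- v)))

Kills : ℕ → Row → (Matrix → ℤ) → Set
Kills n x F = ∀ i → i ℕ.< n → ∀ M → (∀ j → M i j ≡ x j) → F M ≡ + 0

-- The row `x` is exchanged with the rows below it, one after the other, until it stands directly
-- above its copy.
alternating-kills : ∀ n {F} → Extensional F → Alternating (suc n) F → ∀ x → Kills n x (λ M → F (x ◂ M))
alternating-kills (suc n) {F} ext alt x zero i<n M e =
  trans (ext λ { zero j → refl ; (suc zero) j → e j ; (suc (suc i)) j → refl })
        (proj₂ (proj₂ alt) x (M ∘ suc))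
alternating-kills (suc n) {F} ext alt x (suc i) (s≤s i<n) M e = begin
  F (x ◂ M)                      ≡⟨ ext (◂-congʳ x (◂-η M)) ⟩
  F (x ◂ M zero ◂ (M ∘ suc))     ≡⟨ alternating-swap n {F} alt x (M zero) (M ∘ suc) ⟩
  - F (M zero ◂ x ◂ (M ∘ suc))   ≡⟨ cong -_ (alternating-kills n {λ N → F (M zero ◂ N)} (λ e′ → ext (◂-congʳ (M zero) e′))
                                      (proj₁ (proj₂ alt) (M zero)) x i i<n (M ∘ suc) e) ⟩
  - + 0 ∎

-- Linearity in a row produces one extra term with `x` in that row, and this term is killed; the
-- rows are treated from the top down.
add-killed-multiples : ∀ n {F} → Extensional F → Alternating n F → ∀ x → Kills n x F →
  ∀ (a : ℕ → ℤ) M → F (λ i → M i ⊕ a i · x) ≡ F M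
add-killed-multiples zero    ext alt x kills a M = alt _ _
add-killed-multiples (suc n) {F} ext (lin , alt , rep) x kills a M = begin
  F (λ i → M i ⊕ a i · x)
    ≡⟨ ext (◂-η _) ⟩
  F (M zero ⊕ a zero · x ◂ N)
    ≡⟨ lin (M zero) (a zero) x N ⟩
  F (M zero ◂ N) + a zero * F (x ◂ N)
    ≡⟨ cong (λ z → F (M zero ◂ N) + a zero * z) (kills zero (s≤s z≤n) (x ◂ N) λ _ → refl) ⟩
  F (M zero ◂ N) + a zero * + 0
    ≡⟨ trans (cong (λ z → F (M zero ◂ N) + z) (*-zeroʳ (a zero))) (+-identityʳ _) ⟩
  F (M zero ◂ N)
    ≡⟨ add-killed-multiples n (λ e → ext (◂-congʳ (M zero) e)) (alt (M zero)) x
         (λ i i<n M′ e → kills (suc i) (s≤s i<n) (M zero ◂ M′) e) (a ∘ suc) (M ∘ suc) ⟩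
  F (M zero ◂ (M ∘ suc))
    ≡⟨ ext (◂-η M) ⟨
  F M ∎
  where
  N : Matrix
  N i = M (suc i) ⊕ a (suc i) · x

-- Convolution and triangular Toeplitz matrices

infixl 7 _⋆_
-- The Cauchy product of power series. The recursion splits the constant term off the second factor,
-- which matches a column of a matrix losing its first row.
_⋆_ : (ℕ → ℤ) → (ℕ → ℤ) → ℕ → ℤ
(f ⋆ a) zero    = f zero * a zero
(f ⋆ a) (suc n) = f (suc n) * a zero + (f ⋆ (a ∘ suc)) n

⋆-congʳ : ∀ f {a b} → (∀ n → a n ≡ b n) → ∀ n → (f ⋆ a) n ≡ (f ⋆ b) n
⋆-congʳ f e zero    = cong (f zero *_) (e zero)
⋆-congʳ f e (suc n) = cong₂ (λ u v → f (suc n) * u + v) (e zero) (⋆-congʳ f (e ∘ suc) n)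

⋆-congˡ : ∀ {f g} a → (∀ n → f n ≡ g n) → ∀ n → (f ⋆ a) n ≡ (g ⋆ a) n
⋆-congˡ a e zero    = cong (_* a zero) (e zero)
⋆-congˡ a e (suc n) = cong₂ (λ u v → u * a zero + v) (e (suc n)) (⋆-congˡ (a ∘ suc) e n)

⋆-linear : ∀ f c a b n → (f ⋆ (λ k → a k + c * b k)) n ≡ (f ⋆ a) n + c * (f ⋆ b) n
⋆-linear f c a b zero    = distrib (f zero) c (a zero) (b zero)
  where
  distrib : ∀ x c u v → x * (u + c * v) ≡ x * u + c * (x * v)
  distrib = solve-∀
⋆-linear f c a b (suc n) =
  trans (cong (λ z → f (suc n) * (a zero + c * b zero) + z) (⋆-linear f c (a ∘ suc) (b ∘ suc) n))
        (distrib (f (suc n)) c (a zero) (b zero) _ _)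
  where
  distrib : ∀ x c u v u′ v′ → x * (u + c * v) + (u′ + c * v′) ≡ x * u + u′ + c * (x * v + v′)
  distrib = solve-∀

⋆-zeroʳ : ∀ f n → (f ⋆ (λ _ → + 0)) n ≡ + 0
⋆-zeroʳ f zero    = *-zeroʳ (f zero)
⋆-zeroʳ f (suc n) = cong₂ _+_ (*-zeroʳ (f (suc n))) (⋆-zeroʳ f n)

-- Read as a series this is 1, read as a row it is the first unit vector.
δ : ℕ → ℤ
δ zero    = + 1
δ (suc _) = + 0

⋆-identityʳ : ∀ f n → (f ⋆ δ) n ≡ f n
⋆-identityʳ f zero    = ℤP.*-identityʳ (f zero)
⋆-identityʳ f (suc n) = trans (cong₂ _+_ (ℤP.*-identityʳ (f (suc n))) (⋆-zeroʳ f n)) (+-identityʳ (f (suc n)))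

⋆-assoc : ∀ f g a n → ((f ⋆ g) ⋆ a) n ≡ (f ⋆ (g ⋆ a)) n
⋆-assoc f g a zero    = ℤP.*-assoc (f zero) (g zero) (a zero)
⋆-assoc f g a (suc n) = begin
  (f (suc n) * g zero + (f ⋆ (g ∘ suc)) n) * a zero + ((f ⋆ g) ⋆ (a ∘ suc)) n
    ≡⟨ cong (λ z → (f (suc n) * g zero + (f ⋆ (g ∘ suc)) n) * a zero + z) (⋆-assoc f g (a ∘ suc) n) ⟩
  (f (suc n) * g zero + (f ⋆ (g ∘ suc)) n) * a zero + (f ⋆ (g ⋆ (a ∘ suc))) n
    ≡⟨ regroup (f (suc n)) (g zero) (a zero) _ _ ⟩
  f (suc n) * (g zero * a zero) + ((f ⋆ (g ⋆ (a ∘ suc))) n + a zero * (f ⋆ (g ∘ suc)) n)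
    ≡⟨ cong (λ z → f (suc n) * (g zero * a zero) + z) (trans
         (⋆-congʳ f (λ k → swap (g (suc k)) (a zero) ((g ⋆ (a ∘ suc)) k)) n)
         (⋆-linear f (a zero) (g ⋆ (a ∘ suc)) (g ∘ suc) n)) ⟨
  f (suc n) * (g zero * a zero) + (f ⋆ (λ k → g (suc k) * a zero + (g ⋆ (a ∘ suc)) k)) n ∎
  where
  regroup : ∀ x y z u v → (x * y + u) * z + v ≡ x * (y * z) + (v + z * u)
  regroup = solve-∀
  swap : ∀ x y u → x * y + u ≡ u + y * x
  swap = solve-∀

-- Multiplication on the left by the lower triangular Toeplitz matrix of f.
toeplitz : (ℕ → ℤ) → Matrix → Matrix
toeplitz f M i j = (f ⋆ (λ k → M k j)) i

-- The Toeplitz matrix has `f 0` on its diagonal, hence is unitriangular. Removing the multiples of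
-- the first row from the rows below leaves the same product for the matrix without its first row.
alternating-toeplitz : ∀ n {F f} → Extensional F → Alternating n F → f 0 ≡ + 1 →
  ∀ M → F (toeplitz f M) ≡ F M
alternating-toeplitz zero    ext alt f0≡1 M = alt _ _
alternating-toeplitz (suc n) {F} {f} ext alt f0≡1 M = begin
  F (toeplitz f M)
    ≡⟨ ext (λ { zero j → trans (cong (_* M zero j) f0≡1) (*-identityˡ (M zero j))
              ; (suc i) j → swap (f (suc i)) (M zero j) _ }) ⟩
  F (M zero ◂ (λ i → toeplitz f (M ∘ suc) i ⊕ f (suc i) · M zero))
    ≡⟨ add-killed-multiples n (λ e → ext (◂-congʳ (M zero) e)) (proj₁ (proj₂ alt) (M zero)) (M zero)
         (alternating-kills n ext alt (M zero)) (f ∘ suc) (toeplitz f (M ∘ suc)) ⟩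
  F (M zero ◂ toeplitz f (M ∘ suc))
    ≡⟨ alternating-toeplitz n (λ e → ext (◂-congʳ (M zero) e)) (proj₁ (proj₂ alt) (M zero)) f0≡1 (M ∘ suc) ⟩
  F (M zero ◂ (M ∘ suc))
    ≡⟨ ext (◂-η M) ⟨
  F M ∎
  where
  swap : ∀ x y u → x * y + u ≡ u + x * y
  swap = solve-∀

-- A sum over ordered pairs (j , punchIn j k) of distinct columns vanishes when
-- its terms cancel under exchanging the two columns.
sum-antisymmetric : ∀ n (φ : Fin (suc n) → Fin n → ℤ) →
  (∀ (j k : Fin n) → toℕ j ℕ.≤ toℕ k → φ (inject₁ j) k + φ (suc k) j ≡ + 0) →
  sumFin (suc n) (λ j → sumFin n (φ j)) ≡ + 0
sum-antisymmetric zero    φ anti = refl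
sum-antisymmetric (suc n) φ anti = begin
  sumFin (suc n) (φ zero) + sumFin (suc n) (λ j → φ (suc j) zero + sumFin n (φ (suc j) ∘ suc))
    ≡⟨ cong (λ z → sumFin (suc n) (φ zero) + z) (sumFin-+ (suc n) (λ j → φ (suc j) zero) (λ j → sumFin n (φ (suc j) ∘ suc))) ⟩
  sumFin (suc n) (φ zero) + (sumFin (suc n) (λ j → φ (suc j) zero) + sumFin (suc n) (λ j → sumFin n (φ (suc j) ∘ suc)))
    ≡⟨ ℤP.+-assoc (sumFin (suc n) (φ zero)) _ _ ⟨
  sumFin (suc n) (φ zero) + sumFin (suc n) (λ j → φ (suc j) zero) + sumFin (suc n) (λ j → sumFin n (φ (suc j) ∘ suc))
    ≡⟨ cong₂ _+_
         (trans (sym (sumFin-+ (suc n) (φ zero) (λ j → φ (suc j) zero))) (sumFin-zero (suc n) λ k → anti zero k z≤n))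
         (sum-antisymmetric n (λ j k → φ (suc j) (suc k)) λ j k j≤k → anti (suc j) (suc k) (s≤s j≤k)) ⟩
  + 0 ∎

-- The cosimplicial identity: for `j ≤ k` the columns `inject₁ j` and `suc k` can be deleted in
-- either order, with the second index adjusted.
punchIn-exchange : ∀ {n} (j k : Fin (suc n)) → toℕ j ℕ.≤ toℕ k → (l : Fin n) →
  punchIn (inject₁ j) (punchIn k l) ≡ punchIn (suc k) (punchIn j l)
punchIn-exchange zero    k       j≤k       l       = refl
punchIn-exchange (suc j) (suc k) (s≤s j≤k) zero    = refl
punchIn-exchange (suc j) (suc k) (s≤s j≤k) (suc l) = cong suc (punchIn-exchange j k j≤k l)

punchIn-inject₁ : ∀ {n} (j k : Fin n) → toℕ j ℕ.≤ toℕ k → punchIn (inject₁ j) k ≡ suc k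
punchIn-inject₁ zero    k       j≤k       = refl
punchIn-inject₁ (suc j) (suc k) (s≤s j≤k) = cong suc (punchIn-inject₁ j k j≤k)

punchIn-suc : ∀ {n} (j k : Fin n) → toℕ j ℕ.≤ toℕ k → punchIn (suc k) j ≡ inject₁ j
punchIn-suc zero    k       j≤k       = refl
punchIn-suc (suc j) (suc k) (s≤s j≤k) = cong suc (punchIn-suc j k j≤k)

-- Minors and congruent matrices

minor : ∀ n → (Fin n → ℕ) → Matrix → ℤ
minor n e M = det n (λ i j → M (toℕ i) (e j))

minor-cong : ∀ n {e e′ : Fin n → ℕ} M → (∀ j → e j ≡ e′ j) → minor n e M ≡ minor n e′ M
minor-cong n M eq = det-cong n λ i j → cong (M (toℕ i)) (eq j)

-- The expansion along the first row gives the first two conditions. If the first two rows agree,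
-- expanding along both gives a sum over ordered pairs of columns, where the two orders of a pair
-- have the same complementary minor and opposite signs.
minor-alternating : ∀ n e → Alternating n (minor n e)
minor-alternating zero    e = λ _ _ → refl
minor-alternating (suc n) e =
  (λ x c y M → trans
    (sumFin-cong (suc n) λ j → distrib (sign (toℕ j)) (x (e j)) c (y (e j)) (minor n (e ∘ punchIn j) M))
    (sumFin-linear (suc n) c (term x M) (term y M))) ,
  (λ x → alternating-sum n (suc n) (λ j → sign (toℕ j) * x (e j)) (λ j → minor n (e ∘ punchIn j))
           λ j → minor-alternating n (e ∘ punchIn j)) ,
  repeated n e
  where
  term : Row → Matrix → Fin (suc n) → ℤ
  term x M j = sign (toℕ j) * x (e j) * minor n (e ∘ punchIn j) M

  distrib : ∀ s u c v d → s * (u + c * v) * d ≡ s * u * d + c * (s * v * d)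
  distrib = solve-∀

  opposite : ∀ s t a b d → s * a * (t * b * d) + - t * b * (s * a * d) ≡ + 0
  opposite = solve-∀

  repeated : ∀ n (e : Fin (suc n) → ℕ) → RepeatedFirstRow n (minor (suc n) e)
  repeated zero    e     = tt
  repeated (suc n) e x M = trans
    (sumFin-cong (suc (suc n)) λ j → sym (sumFin-*ˡ (suc n) (sign (toℕ j) * x (e j))
      λ k → sign (toℕ k) * x (e (punchIn j k)) * minor n (e ∘ punchIn j ∘ punchIn k) M))
    (sum-antisymmetric (suc n) φ anti)
    where
    φ : Fin (suc (suc n)) → Fin (suc n) → ℤ
    φ j k = sign (toℕ j) * x (e j) *
      (sign (toℕ k) * x (e (punchIn j k)) * minor n (e ∘ punchIn j ∘ punchIn k) M)
    anti : ∀ j k → toℕ j ℕ.≤ toℕ k → φ (inject₁ j) k + φ (suc k) j ≡ + 0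
    anti j k j≤k
      rewrite toℕ-inject₁ j | punchIn-inject₁ j k j≤k | punchIn-suc j k j≤k | sign-suc (toℕ k)
            | minor-cong n {e ∘ punchIn (inject₁ j) ∘ punchIn k} {e ∘ punchIn (suc k) ∘ punchIn j} M
                (λ l → cong e (punchIn-exchange j k j≤k l))
      = opposite (sign (toℕ j)) (sign (toℕ k)) (x (e (inject₁ j))) (x (e (suc k)))
          (minor n (e ∘ punchIn (suc k) ∘ punchIn j) M)

leadingMinor : ℕ → Matrix → ℤ
leadingMinor n = minor n toℕ

leadingMinor-cong : ∀ n → Extensional (leadingMinor n)
leadingMinor-cong n e = det-cong n λ i j → e (toℕ i) (toℕ j)

-- This is `L M Lᵀ`, where `L` is the lower triangular Toeplitz matrix of `f`.
congruence : (ℕ → ℤ) → Matrix → Matrix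
congruence f M i j = (f ⋆ (λ k → (f ⋆ M k) j)) i

leadingMinor-congruence : ∀ n {f} → f 0 ≡ + 1 → ∀ M → leadingMinor n (congruence f M) ≡ leadingMinor n M
leadingMinor-congruence n {f} f0≡1 M = begin
  leadingMinor n (congruence f M)
    ≡⟨ alternating-toeplitz n (leadingMinor-cong n) (minor-alternating n toℕ) f0≡1 (λ k j → (f ⋆ M k) j) ⟩
  leadingMinor n (λ k j → (f ⋆ M k) j)
    ≡⟨ det-transpose n (λ k j → (f ⋆ M (toℕ k)) (toℕ j)) ⟩
  leadingMinor n (toeplitz f (λ i j → M j i))
    ≡⟨ alternating-toeplitz n (leadingMinor-cong n) (minor-alternating n toℕ) f0≡1 (λ i j → M j i) ⟩
  leadingMinor n (λ i j → M j i)
    ≡⟨ det-transpose n (λ i j → M (toℕ j) (toℕ i)) ⟩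
  leadingMinor n M ∎

-- Hankel determinants of 1 / (1 - x u)

⋆-+ˡ : ∀ f g a n → ((λ k → f k + g k) ⋆ a) n ≡ (f ⋆ a) n + (g ⋆ a) n
⋆-+ˡ f g a zero    = ℤP.*-distribʳ-+ (a 0) (f 0) (g 0)
⋆-+ˡ f g a (suc n) = trans (cong (λ z → (f (suc n) + g (suc n)) * a 0 + z) (⋆-+ˡ f g (a ∘ suc) n))
  (interchange (f (suc n)) (g (suc n)) (a 0) ((f ⋆ (a ∘ suc)) n) ((g ⋆ (a ∘ suc)) n))
  where
  interchange : ∀ x y z u v → (x + y) * z + (u + v) ≡ x * z + u + (y * z + v)
  interchange = solve-∀

⋆-sucˡ : ∀ f a n → (f ⋆ a) (suc n) ≡ f 0 * a (suc n) + ((f ∘ suc) ⋆ a) n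
⋆-sucˡ f a zero    = ℤP.+-comm (f 1 * a 0) (f 0 * a 1)
⋆-sucˡ f a (suc n) = trans
  (cong (λ z → f (suc (suc n)) * a 0 + z) (⋆-sucˡ f (a ∘ suc) n))
  (swap (f (suc (suc n)) * a 0) (f 0 * a (suc (suc n))) (((f ∘ suc) ⋆ (a ∘ suc)) n))
  where
  swap : ∀ x y z → x + (y + z) ≡ y + (x + z)
  swap = solve-∀

hankelMatrix : (ℕ → ℤ) → Matrix
hankelMatrix f i j = f (i ℕ.+ j)

hankel-cong : ∀ n {f g} → (∀ k → f k ≡ g k) → hankel f n ≡ hankel g n
hankel-cong n e = leadingMinor-cong n λ i j → e (i ℕ.+ j)

leadingMinor-δ : ∀ n M → leadingMinor (suc n) (δ ◂ M) ≡ leadingMinor n (λ i j → M i (suc j))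
leadingMinor-δ n M = begin
  + 1 * + 1 * leadingMinor n (λ i j → M i (suc j)) + sumFin n (λ j → sign (suc (toℕ j)) * + 0 * d j)
    ≡⟨ cong₂ _+_ (*-identityˡ (leadingMinor n (λ i j → M i (suc j))))
         (sumFin-zero n {λ j → sign (suc (toℕ j)) * + 0 * d j} λ j → cong (_* d j) (*-zeroʳ (sign (suc (toℕ j))))) ⟩
  leadingMinor n (λ i j → M i (suc j)) + + 0
    ≡⟨ +-identityʳ (leadingMinor n (λ i j → M i (suc j))) ⟩
  leadingMinor n (λ i j → M i (suc j)) ∎
  where
  d : Fin n → ℤ
  d j = minor n (toℕ ∘ punchIn (suc j)) M

-- Only the corner entry changes, and its cofactor is the Hankel determinant of the sequence shifted
-- twice.
hankel-+δ : ∀ n a c →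
  hankel (λ k → a k + c * δ k) (suc n) ≡ hankel a (suc n) + c * hankel (λ k → a (suc (suc k))) n
hankel-+δ n a c = begin
  hankel (λ k → a k + c * δ k) (suc n)
    ≡⟨ leadingMinor-cong (suc n) {hankelMatrix (λ k → a k + c * δ k)} {a ⊕ c · δ ◂ N} (λ { zero j → refl
         ; (suc i) j → trans (cong (λ z → a (suc i ℕ.+ j) + z) (*-zeroʳ c)) (+-identityʳ (a (suc i ℕ.+ j))) }) ⟩
  leadingMinor (suc n) (a ⊕ c · δ ◂ N)
    ≡⟨ proj₁ (minor-alternating (suc n) toℕ) a c δ N ⟩
  leadingMinor (suc n) (a ◂ N) + c * leadingMinor (suc n) (δ ◂ N)
    ≡⟨ cong₂ (λ u v → u + c * v)
         (leadingMinor-cong (suc n) {a ◂ N} {hankelMatrix a} λ { zero j → refl ; (suc i) j → refl })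
         (trans (leadingMinor-δ n N)
                (leadingMinor-cong n {λ i j → N i (suc j)} {hankelMatrix (λ k → a (suc (suc k)))} λ i j → cong a (ℕP.+-suc (suc i) j))) ⟩
  hankel a (suc n) + c * hankel (λ k → a (suc (suc k))) n ∎
  where
  N : Matrix
  N i j = a (suc i ℕ.+ j)

-- The power series identity f = 1 / (1 - x u).
infix 4 _≗1/1-x_
_≗1/1-x_ : (ℕ → ℤ) → (ℕ → ℤ) → Set
f ≗1/1-x u = (f 0 ≡ + 1) × (∀ n → f (suc n) ≡ (f ⋆ u) n)

unit-*ˡ : ∀ {c} → c ≡ + 1 → ∀ x → c * x ≡ x
unit-*ˡ c≡1 x = trans (cong (_* x) c≡1) (*-identityˡ x)

-- For f = 1 / (1 - x u), the Hankel matrix of the shift of f has generating function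
-- (f(x) - f(y)) / (x - y) = f(x) f(y) (x u(x) - y u(y)) / (x - y), whose last factor belongs to u.
congruence-hankelMatrix : ∀ {f u} → f ≗1/1-x u → ∀ i j →
  congruence f (hankelMatrix u) i j ≡ f (suc (i ℕ.+ j))
congruence-hankelMatrix {f} {u} (f0≡1 , f-suc) = entry
  where
  W : Matrix
  W = congruence f (hankelMatrix u)

  -- `W` is constant along antidiagonals, because both entries are the sum `tail` plus
  -- `f (suc i) * f (suc j)`; its first column therefore determines it.
  shift-index : ∀ i j → W i (suc j) ≡ W (suc i) j
  shift-index i j = begin
    (f ⋆ (λ k → f (suc j) * u (k ℕ.+ 0) + (f ⋆ (λ l → u (k ℕ.+ suc l))) j)) i
      ≡⟨ ⋆-congʳ f (λ k → trans
           (cong₂ _+_ (cong (λ z → f (suc j) * u z) (ℕP.+-identityʳ k))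
                      (⋆-congʳ f (λ l → cong u (ℕP.+-suc k l)) j))
           (ℤP.+-comm (f (suc j) * u k) ((f ⋆ hankelMatrix u (suc k)) j))) i ⟩
    (f ⋆ (λ k → (f ⋆ hankelMatrix u (suc k)) j + f (suc j) * u k)) i
      ≡⟨ ⋆-linear f (f (suc j)) (λ k → (f ⋆ hankelMatrix u (suc k)) j) u i ⟩
    tail + f (suc j) * (f ⋆ u) i
      ≡⟨ cong₂ (λ x y → tail + x * y) (f-suc j) (sym (f-suc i)) ⟩
    tail + (f ⋆ u) j * f (suc i)
      ≡⟨ swap tail ((f ⋆ u) j) (f (suc i)) ⟩
    f (suc i) * (f ⋆ u) j + tail ∎
    where
    tail : ℤ
    tail = (f ⋆ (λ k → (f ⋆ hankelMatrix u (suc k)) j)) i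
    swap : ∀ x y z → x + y * z ≡ z * y + x
    swap = solve-∀

  entry : ∀ i j → W i j ≡ f (suc (i ℕ.+ j))
  entry i zero = begin
    (f ⋆ (λ k → f 0 * u (k ℕ.+ 0))) i
      ≡⟨ ⋆-congʳ f (λ k → trans (unit-*ˡ f0≡1 (u (k ℕ.+ 0))) (cong u (ℕP.+-identityʳ k))) i ⟩
    (f ⋆ u) i
      ≡⟨ f-suc i ⟨
    f (suc i)
      ≡⟨ cong (f ∘ suc) (ℕP.+-identityʳ i) ⟨
    f (suc (i ℕ.+ 0)) ∎
  entry i (suc j) = trans (shift-index i j) (trans (entry (suc i) j) (cong (f ∘ suc) (sym (ℕP.+-suc i j))))

hankel-shift : ∀ {f u} → f ≗1/1-x u → ∀ n → hankel (f ∘ suc) n ≡ hankel u n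
hankel-shift {f} {u} f≗ n = begin
  hankel (f ∘ suc) n
    ≡⟨ leadingMinor-cong n {N = hankelMatrix (f ∘ suc)} (congruence-hankelMatrix f≗) ⟨
  leadingMinor n (congruence f (hankelMatrix u))
    ≡⟨ leadingMinor-congruence n {f} (proj₁ f≗) (hankelMatrix u) ⟩
  hankel u n ∎

border : Matrix → Matrix
border M = δ ◂ λ { k zero → + 0 ; k (suc l) → M k l }

-- Likewise (x f(x) - y f(y)) / (x - y) = f(x) f(y) (1 + x y (u(x) - u(y)) / (x - y)).
congruence-border : ∀ {f u} → f ≗1/1-x u → ∀ i j →
  congruence f (border (hankelMatrix (u ∘ suc))) i j ≡ f (i ℕ.+ j)
congruence-border {f} {u} f≗@(f0≡1 , f-suc) zero j =
  trans (unit-*ˡ f0≡1 ((f ⋆ δ) j)) (⋆-identityʳ f j)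
congruence-border {f} {u} f≗@(f0≡1 , f-suc) (suc i) zero = begin
  f (suc i) * (f 0 * + 1) + (f ⋆ (λ k → f 0 * + 0)) i
    ≡⟨ cong₂ (λ x y → f (suc i) * x + y) (unit-*ˡ f0≡1 (+ 1))
         (trans (⋆-congʳ f (λ _ → *-zeroʳ (f 0)) i) (⋆-zeroʳ f i)) ⟩
  f (suc i) * + 1 + + 0
    ≡⟨ trans (+-identityʳ (f (suc i) * + 1)) (ℤP.*-identityʳ (f (suc i))) ⟩
  f (suc i)
    ≡⟨ cong f (ℕP.+-identityʳ (suc i)) ⟨
  f (suc i ℕ.+ 0) ∎
congruence-border {f} {u} f≗@(f0≡1 , f-suc) (suc i) (suc j) = begin
  f (suc i) * (f ⋆ δ) (suc j) +
  (f ⋆ (λ k → f (suc j) * + 0 + (f ⋆ hankelMatrix u (suc k)) j)) i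
    ≡⟨ cong₂ (λ x y → f (suc i) * x + y)
         (trans (⋆-identityʳ f (suc j)) (f-suc j))
         (⋆-congʳ f (λ k → trans (cong (_+ (f ⋆ hankelMatrix u (suc k)) j) (*-zeroʳ (f (suc j)))) (+-identityˡ ((f ⋆ hankelMatrix u (suc k)) j))) i) ⟩
  congruence f (hankelMatrix u) (suc i) j
    ≡⟨ congruence-hankelMatrix f≗ (suc i) j ⟩
  f (suc (suc (i ℕ.+ j)))
    ≡⟨ cong (f ∘ suc) (ℕP.+-suc i j) ⟨
  f (suc (i ℕ.+ suc j)) ∎

hankel-suc : ∀ {f u} → f ≗1/1-x u → ∀ n → hankel f (suc n) ≡ hankel (u ∘ suc) n
hankel-suc {f} {u} f≗ n = begin
  hankel f (suc n)
    ≡⟨ leadingMinor-cong (suc n) {N = hankelMatrix f} (congruence-border f≗) ⟨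
  leadingMinor (suc n) (congruence f (border (hankelMatrix (u ∘ suc))))
    ≡⟨ leadingMinor-congruence (suc n) {f} (proj₁ f≗) (border (hankelMatrix (u ∘ suc))) ⟩
  leadingMinor (suc n) (border (hankelMatrix (u ∘ suc)))
    ≡⟨ leadingMinor-δ n (border (hankelMatrix (u ∘ suc)) ∘ suc) ⟩
  hankel (u ∘ suc) n ∎

-- If f = 1 / (1 - x g) and g = 1 / (1 - x u), then (f - 1) / x = f g = 1 / (1 - x (u + 1)).
≗1/1-x-shift : ∀ {f g u} → f ≗1/1-x g → g ≗1/1-x u → (f ∘ suc) ≗1/1-x (λ n → u n + + 1 * δ n)
≗1/1-x-shift {f} {g} {u} (f0≡1 , f-suc) (g0≡1 , g-suc) =
  trans (f-suc 0) (cong₂ _*_ f0≡1 g0≡1) , λ n → begin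
    q (suc n)
      ≡⟨ trans (q-suc n) (cong (λ z → z + (q ⋆ g) n) (g-suc n)) ⟩
    (g ⋆ u) n + (q ⋆ g) n
      ≡⟨ key n ⟩
    (q ⋆ u) n + + 1 * q n
      ≡⟨ cong (λ z → (q ⋆ u) n + + 1 * z) (⋆-identityʳ q n) ⟨
    (q ⋆ u) n + + 1 * (q ⋆ δ) n
      ≡⟨ ⋆-linear q (+ 1) u δ n ⟨
    (q ⋆ (λ k → u k + + 1 * δ k)) n ∎
  where
  q : ℕ → ℤ
  q = f ∘ suc

  q-suc : ∀ n → q (suc n) ≡ g (suc n) + (q ⋆ g) n
  q-suc n = trans (f-suc (suc n)) (trans (⋆-sucˡ f g n)
    (cong (λ z → z + (q ⋆ g) n) (unit-*ˡ f0≡1 (g (suc n)))))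

  q0≡g0 : q 0 ≡ g 0
  q0≡g0 = trans (f-suc 0) (unit-*ˡ f0≡1 (g 0))

  rearrange : ∀ a b c → a + (c * + 1 + b) ≡ a + b + + 1 * c
  rearrange = solve-∀

  -- As series, `g u + q g = q u + q`: both sides equal `g u + q + x q g u`, on the left by
  -- `g = 1 + x g u` and on the right by `q = g + x q g`.
  key : ∀ n → (g ⋆ u) n + (q ⋆ g) n ≡ (q ⋆ u) n + + 1 * q n
  key zero = cong₂ _+_ (cong (_* u 0) (sym q0≡g0))
    (trans (cong (λ z → q 0 * z) g0≡1) (ℤP.*-comm (q 0) (+ 1)))
  key (suc n) = begin
    (g ⋆ u) (suc n) + (q (suc n) * g 0 + (q ⋆ (g ∘ suc)) n)
      ≡⟨ cong₂ (λ x y → (g ⋆ u) (suc n) + (q (suc n) * x + y)) g0≡1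
           (trans (⋆-congʳ q g-suc n) (sym (⋆-assoc q g u n))) ⟩
    (g ⋆ u) (suc n) + (q (suc n) * + 1 + ((q ⋆ g) ⋆ u) n)
      ≡⟨ rearrange ((g ⋆ u) (suc n)) (((q ⋆ g) ⋆ u) n) (q (suc n)) ⟩
    (g ⋆ u) (suc n) + ((q ⋆ g) ⋆ u) n + + 1 * q (suc n)
      ≡⟨ cong (λ z → z + + 1 * q (suc n)) (begin
           (g ⋆ u) (suc n) + ((q ⋆ g) ⋆ u) n
             ≡⟨ cong (λ z → z + ((q ⋆ g) ⋆ u) n) (⋆-sucˡ g u n) ⟩
           g 0 * u (suc n) + ((g ∘ suc) ⋆ u) n + ((q ⋆ g) ⋆ u) n
             ≡⟨ ℤP.+-assoc (g 0 * u (suc n)) (((g ∘ suc) ⋆ u) n) (((q ⋆ g) ⋆ u) n) ⟩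
           g 0 * u (suc n) + (((g ∘ suc) ⋆ u) n + ((q ⋆ g) ⋆ u) n)
             ≡⟨ cong₂ (λ x y → x * u (suc n) + y) (sym q0≡g0) (trans (sym (⋆-+ˡ (g ∘ suc) (q ⋆ g) u n))
                  (⋆-congˡ u (λ k → sym (q-suc k)) n)) ⟩
           q 0 * u (suc n) + ((q ∘ suc) ⋆ u) n
             ≡⟨ ⋆-sucˡ q u n ⟨
           (q ⋆ u) (suc n) ∎) ⟩
    (q ⋆ u) (suc n) + + 1 * q (suc n) ∎

-- Climbing through the levels

ε : Bool → ℤ
ε false = + 0
ε true  = + 1

-- The rational recursion in integer numerators and denominators

ι : ℤ → ℚ
ι i = ℚ._/_ i 1

toℚᵘ-ι : ∀ i → ℚ.toℚᵘ (ι i) ℚᵘ.≃ mkℚᵘ i 0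
toℚᵘ-ι i = ℚP.toℚᵘ-fromℚᵘ (mkℚᵘ i 0)

ι-injective : ∀ {i j} → ι i ≡ ι j → i ≡ j
ι-injective {i} {j} e with ℚP.fromℚᵘ-injective {mkℚᵘ i 0} {mkℚᵘ j 0} e
... | *≡* eq = trans (sym (ℤP.*-identityʳ i)) (trans eq (ℤP.*-identityʳ j))

ι-+ : ∀ i j → ι (i + j) ≡ ι i ℚ.+ ι j
ι-+ i j = ℚP.toℚᵘ-injective (ℚᵘP.≃-trans (toℚᵘ-ι (i + j)) (ℚᵘP.≃-trans (*≡* (unfold i j))
  (ℚᵘP.≃-sym (ℚᵘP.≃-trans (ℚP.toℚᵘ-homo-+ (ι i) (ι j)) (ℚᵘP.+-cong (toℚᵘ-ι i) (toℚᵘ-ι j))))))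
  where
  unfold : ∀ i j → (i + j) * + 1 ≡ (i * + 1 + j * + 1) * + 1
  unfold = solve-∀

ι-* : ∀ i j → ι (i * j) ≡ ι i ℚ.* ι j
ι-* i j = ℚP.toℚᵘ-injective (ℚᵘP.≃-trans (toℚᵘ-ι (i * j)) (ℚᵘP.≃-trans (*≡* refl)
  (ℚᵘP.≃-sym (ℚᵘP.≃-trans (ℚP.toℚᵘ-homo-* (ι i) (ι j)) (ℚᵘP.*-cong (toℚᵘ-ι i) (toℚᵘ-ι j))))))

ι-neg : ∀ i → ι (- i) ≡ ℚ.- ι i
ι-neg i = ℚP.toℚᵘ-injective (ℚᵘP.≃-trans (toℚᵘ-ι (- i))
  (ℚᵘP.≃-sym (ℚᵘP.≃-trans (ℚP.toℚᵘ-homo‿- (ι i)) (ℚᵘP.-‿cong (toℚᵘ-ι i)))))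

-- The numerator keeps this form because it is that of the map `(p , r) ↦ ((2 - t) p - r , p)` at
-- `(1 , 0)`, where `p / r` is infinite; the first entry of a block thus becomes an ordinary step.
fraction-start : ∀ t → (ℕtoℚ 2 ℚ.- ℕtoℚ t) ℚ.* ι (+ 1) ≡ ι ((+ 2 + - + t) * + 1 + - + 0)
fraction-start t = begin
  (ι (+ 2) ℚ.- ι (+ t)) ℚ.* ι (+ 1)        ≡⟨ ℚP.*-identityʳ (ι (+ 2) ℚ.- ι (+ t)) ⟩
  ι (+ 2) ℚ.- ι (+ t)                      ≡⟨ cong (λ z → ι (+ 2) ℚ.+ z) (ι-neg (+ t)) ⟨
  ι (+ 2) ℚ.+ ι (- + t)                    ≡⟨ ι-+ (+ 2) (- + t) ⟨
  ι (+ 2 + - + t)                          ≡⟨ cong ι (pad (+ 2 + - + t)) ⟩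
  ι ((+ 2 + - + t) * + 1 + - + 0)          ∎
  where
  pad : ∀ x → x ≡ x * + 1 + - + 0
  pad = solve-∀

-- For `q = p / r` the next value `2 - t - 1 / q` is `((2 - t) p - r) / p`; multiplied out, this
-- involves no division by `r`.
fraction-step : ∀ t {q} (nz : q ≢ 0ℚ) {p r} → q ℚ.* ι r ≡ ι p →
  (ℕtoℚ 2 ℚ.- ℕtoℚ t ℚ.- (1/ q) {{≢-nonZero nz}}) ℚ.* ι p ≡ ι ((+ 2 + - + t) * p + - r)
fraction-step t {q} nz {p} {r} e = begin
  (ι (+ 2) ℚ.- ι (+ t) ℚ.- q⁻¹) ℚ.* ι p
    ≡⟨ ℚP.*-distribʳ-+ (ι p) (ι (+ 2) ℚ.- ι (+ t)) (ℚ.- q⁻¹) ⟩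
  (ι (+ 2) ℚ.- ι (+ t)) ℚ.* ι p ℚ.+ ℚ.- q⁻¹ ℚ.* ι p
    ≡⟨ cong₂ ℚ._+_ (trans (cong (ℚ._* ι p) (trans (cong (λ z → ι (+ 2) ℚ.+ z) (sym (ι-neg (+ t)))) (sym (ι-+ (+ 2) (- + t)))))
                     (sym (ι-* (+ 2 + - + t) p)))
                   (trans (sym (ℚP.neg-distribˡ-* q⁻¹ (ι p))) (trans (cong ℚ.-_ cancel) (sym (ι-neg r)))) ⟩
  ι ((+ 2 + - + t) * p) ℚ.+ ι (- r)
    ≡⟨ ι-+ ((+ 2 + - + t) * p) (- r) ⟨
  ι ((+ 2 + - + t) * p + - r) ∎
  where
  instance _ = ≢-nonZero nz
  q⁻¹ : ℚ
  q⁻¹ = 1/ q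
  cancel : q⁻¹ ℚ.* ι p ≡ ι r
  cancel = begin
    q⁻¹ ℚ.* ι p            ≡⟨ cong (q⁻¹ ℚ.*_) e ⟨
    q⁻¹ ℚ.* (q ℚ.* ι r)    ≡⟨ ℚP.*-assoc q⁻¹ q (ι r) ⟨
    q⁻¹ ℚ.* q ℚ.* ι r      ≡⟨ cong (ℚ._* ι r) (ℚP.*-inverseˡ q) ⟩
    ℚ.1ℚ ℚ.* ι r           ≡⟨ ℚP.*-identityˡ (ι r) ⟩
    ι r                    ∎

unit-square : ∀ y r → y * r ≡ + 1 → r * r ≡ + 1
unit-square y r e with ℕP.m*n≡1⇒n≡1 ℤ.∣ y ∣ ℤ.∣ r ∣ (trans (sym (ℤP.abs-* y r)) (cong ℤ.∣_∣ e))
unit-square y (+ .1)    e | refl = refl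
unit-square y -[1+ .0 ] e | refl = refl

double : ℕ → ℕ
double zero    = zero
double (suc n) = suc (suc (double n))

double≡+ : ∀ n → double n ≡ n ℕ.+ n
double≡+ zero    = refl
double≡+ (suc n) = cong suc (trans (cong suc (double≡+ n)) (sym (ℕP.+-suc n n)))

-- Hankel determinants from level to level

module Levels (bad : ℕ → Bool) (f : ℕ → ℕ → ℤ)
  (f-unfold : ∀ h → f h ≗1/1-x (λ k → f (suc h) k + - ε (bad (suc h)) * δ k)) where

  -- `B n h` is the cofactor of the corner entry in the Hankel matrix of `A n h`. It is set to 0 at
  -- size 0, where there is no corner, so that `hankel-+cδ` holds for every `n`.
  A A₁ B : ℕ → ℕ → ℤ
  A n h        = hankel (f h) n
  A₁ n h       = hankel (λ k → f h (suc k)) n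
  B zero h     = + 0
  B (suc n) h  = hankel (λ k → f h (suc (suc k))) n

  -- Whether `h + 1` is forbidden affects only the constant term of the next series, and the shift
  -- drops this term.
  A-suc : ∀ n h → A (suc n) h ≡ A₁ n (suc h)
  A-suc n h = trans (hankel-suc (f-unfold h) n)
    (hankel-cong n λ k → trans (cong (λ z → f (suc h) (suc k) + z) (*-zeroʳ (- ε (bad (suc h)))))
                               (+-identityʳ (f (suc h) (suc k))))

  hankel-+cδ : ∀ n h c → hankel (λ k → f h k + c * δ k) n ≡ A n h + c * B n h
  hankel-+cδ zero    h c = sym (trans (cong (λ z → + 1 + z) (*-zeroʳ c)) refl)
  hankel-+cδ (suc n) h c = hankel-+δ n (f h) c

  A₁-step : ∀ n h → A₁ n h ≡ A n (suc h) + - ε (bad (suc h)) * B n (suc h)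
  A₁-step n h = trans (hankel-shift (f-unfold h) n) (hankel-+cδ n (suc h) (- ε (bad (suc h))))

  A₁-good : ∀ n h → bad (suc h) ≡ false → A₁ n h ≡ A n (suc h)
  A₁-good n h g = trans (A₁-step n h)
    (trans (cong (λ b → A n (suc h) + - ε b * B n (suc h)) g) (+-identityʳ (A n (suc h))))

  A₁-bad : ∀ n h → bad (suc h) ≡ true → A₁ n h ≡ A n (suc h) + - + 1 * B n (suc h)
  A₁-bad n h g = trans (A₁-step n h) (cong (λ b → A n (suc h) + - ε b * B n (suc h)) g)

  -- If `h + 1` is allowed, `≗1/1-x-shift` writes `(f h - 1) / x` as `1 / (1 - x v)`, where `v` is
  -- `f (h + 2)` with a modified constant term. The second shift then yields the Hankel determinants
  -- of `v`.
  B-step : ∀ n h → bad (suc h) ≡ false →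
    B (suc n) h ≡ A n (suc (suc h)) + (- ε (bad (suc (suc h))) + + 1) * B n (suc (suc h))
  B-step n h g = begin
    hankel (λ k → f h (suc (suc k))) n
      ≡⟨ hankel-shift (≗1/1-x-shift f≗ (f-unfold (suc h))) n ⟩
    hankel (λ k → f (suc (suc h)) k + c * δ k + + 1 * δ k) n
      ≡⟨ hankel-cong n (λ k → regroup (f (suc (suc h)) k) c (δ k)) ⟩
    hankel (λ k → f (suc (suc h)) k + (c + + 1) * δ k) n
      ≡⟨ hankel-+cδ n (suc (suc h)) (c + + 1) ⟩
    A n (suc (suc h)) + (c + + 1) * B n (suc (suc h)) ∎
    where
    c : ℤ
    c = - ε (bad (suc (suc h)))
    regroup : ∀ x c y → x + c * y + + 1 * y ≡ x + (c + + 1) * y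
    regroup = solve-∀
    f≗ : f h ≗1/1-x f (suc h)
    f≗ = proj₁ (f-unfold h) , λ n → trans (proj₂ (f-unfold h) n)
      (⋆-congʳ (f h) (λ k → trans (cong (λ b → f (suc h) k + - ε b * δ k) g) (+-identityʳ (f (suc h) k))) n)

  -- Up to the factor p - r this is the Hankel determinant of f h - c with c = p / (p - r);
  -- the numbers h(t₁,…,t_j) of the paper are the values p / r at the ends of the steps of a block.
  Y : ℤ → ℤ → ℕ → ℕ → ℤ
  Y p r n h = (p + - r) * A n h + - p * B n h

  -- With `q = p / r`, a pair of allowed levels adds 1 to `1 / q`.
  Y-good : ∀ p r n h → bad (suc h) ≡ false → bad (suc (suc h)) ≡ false →
    Y p r (suc n) h ≡ Y p (r + p) n (suc (suc h))
  Y-good p r n h g₁ g₂ = begin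
    (p + - r) * A (suc n) h + - p * B (suc n) h
      ≡⟨ cong₂ (λ u v → (p + - r) * u + - p * v) (trans (A-suc n h) (A₁-good n (suc h) g₂))
           (trans (B-step n h g₁) (cong (λ b → a + (- ε b + + 1) * b′) g₂)) ⟩
    (p + - r) * a + - p * (a + (- + 0 + + 1) * b′)
      ≡⟨ regroup p r a b′ ⟩
    (p + - (r + p)) * a + - p * b′ ∎
    where
    a b′ : ℤ
    a = A n (suc (suc h))
    b′ = B n (suc (suc h))
    regroup : ∀ p r a b → (p + - r) * a + - p * (a + (- + 0 + + 1) * b) ≡ (p + - (r + p)) * a + - p * b
    regroup = solve-∀

  -- Here `q` becomes `1 - 1 / q`. After `t - 1` allowed pairs this amounts to `2 - t - 1 / q` in
  -- terms of the earlier `q`, which is the recursion for `h(t₁,…,t_j)`.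
  Y-bad : ∀ p r n h → bad (suc h) ≡ false → bad (suc (suc h)) ≡ true →
    Y p r (suc n) h ≡ Y (p + - r) p n (suc (suc h))
  Y-bad p r n h g₁ g₂ = begin
    (p + - r) * A (suc n) h + - p * B (suc n) h
      ≡⟨ cong₂ (λ u v → (p + - r) * u + - p * v) (trans (A-suc n h) (A₁-bad n (suc h) g₂))
           (trans (B-step n h g₁) (cong (λ b → a + (- ε b + + 1) * b′) g₂)) ⟩
    (p + - r) * (a + - + 1 * b′) + - p * (a + (- + 1 + + 1) * b′)
      ≡⟨ regroup p r a b′ ⟩
    (p + - r + - p) * a + - (p + - r) * b′ ∎
    where
    a b′ : ℤ
    a = A n (suc (suc h))
    b′ = B n (suc (suc h))
    regroup : ∀ p r a b → (p + - r) * (a + - + 1 * b) + - p * (a + (- + 1 + + 1) * b) ≡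
      (p + - r + - p) * a + - (p + - r) * b
    regroup = solve-∀

  -- Levels are taken in pairs. An entry `t` stands for `t - 1` allowed pairs followed by a pair
  -- whose upper height is forbidden; the lower height of a pair is always allowed.
  data Block : ℕ → List ℕ → ℕ → Set where
    done : ∀ {h} → Block h [] h
    good : ∀ {h t ts e} → bad (suc h) ≡ false → bad (suc (suc h)) ≡ false →
           Block (suc (suc h)) (t ∷ ts) e → Block h (suc t ∷ ts) e
    next : ∀ {h ts e} → bad (suc h) ≡ false → bad (suc (suc h)) ≡ true →
           Block (suc (suc h)) ts e → Block h (1 ∷ ts) e

  Block-end : ∀ {h ts e} → Block h ts e → e ≡ double (sum ts) ℕ.+ h
  Block-end done = refl
  Block-end {h} {suc t ∷ ts} (good g₁ g₂ blk) = trans (Block-end blk)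
    (trans (ℕP.+-suc (double (t ℕ.+ sum ts)) (suc h)) (cong suc (ℕP.+-suc (double (t ℕ.+ sum ts)) h)))
  Block-end {h} {_ ∷ ts} (next g₁ g₂ blk) = trans (Block-end blk)
    (trans (ℕP.+-suc (double (sum ts)) (suc h)) (cong suc (ℕP.+-suc (double (sum ts)) h)))

  -- Shifted determinants do not notice the forbidden heights of a block: `A₁-good` is applied only
  -- to the lower heights of pairs, and `A-suc`, used for the upper ones, holds unconditionally.
  A₁-block : ∀ {h ts e} → Block h ts e → ∀ n → A₁ (sum ts ℕ.+ n) h ≡ A₁ n e
  A₁-block done n = refl
  A₁-block {h} {suc t ∷ ts} (good g₁ g₂ blk) n = trans (A₁-good (suc (t ℕ.+ sum ts ℕ.+ n)) h g₁)
    (trans (A-suc (t ℕ.+ sum ts ℕ.+ n) (suc h)) (A₁-block blk n))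
  A₁-block {h} {_ ∷ ts} (next g₁ g₂ blk) n = trans (A₁-good (suc (sum ts ℕ.+ n)) h g₁)
    (trans (A-suc (sum ts ℕ.+ n) (suc h)) (A₁-block blk n))

  Block-step : ∀ {h t ts e} → Block h (t ∷ ts) e →
    Σ ℕ λ h′ → Block h′ ts e × (∀ p r n → Y p r (t ℕ.+ n) h ≡ Y ((+ 2 + - + t) * p + - r) p n h′)
  Block-step {h} (good {t = t} g₁ g₂ blk) with Block-step blk
  ... | h′ , blk′ , move = h′ , blk′ , λ p r n → trans (Y-good p r (t ℕ.+ n) h g₁ g₂)
    (trans (move p (r + p) n) (cong (λ z → Y z p n h′) (regroup (+ t) p r)))
    where
    regroup : ∀ t p r → (+ 2 + - t) * p + - (r + p) ≡ (+ 2 + - (+ 1 + t)) * p + - r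
    regroup = solve-∀
  Block-step {h} (next g₁ g₂ blk) = suc (suc h) , blk , λ p r n → trans (Y-bad p r n h g₁ g₂)
    (cong (λ z → Y z p n (suc (suc h))) (regroup p r))
    where
    regroup : ∀ p r → p + - r ≡ (+ 2 + - + 1) * p + - r
    regroup = solve-∀

  -- The pair (p , r) stays coprime, so that r is a unit when p = 0 is reached.
  Y-block : ∀ {q ts h e} → PrimFrom q ts → ∀ {p r x y} → q ℚ.* ι r ≡ ι p → x * p + y * r ≡ + 1 →
    Block h ts e → Σ ℤ λ σ → (σ * σ ≡ + 1) × (∀ n → Y p r (sum ts ℕ.+ n) h ≡ σ * A n e)
  Y-block {h = h} (stop q≡0) {p} {r} {x} {y} qr≡p bezout done =
    - r , trans (neg-square r) (unit-square y r yr≡1) , λ n →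
      trans (cong (λ z → Y z r n h) p≡0) (simplify r (A n h) (B n h))
    where
    p≡0 : p ≡ + 0
    p≡0 = ι-injective (trans (sym qr≡p) (trans (cong (ℚ._* ι r) q≡0) (ℚP.*-zeroˡ (ι r))))
    vanish : ∀ x y r → x * + 0 + y * r ≡ y * r
    vanish = solve-∀
    yr≡1 : y * r ≡ + 1
    yr≡1 = trans (sym (vanish x y r)) (trans (cong (λ z → x * z + y * r) (sym p≡0)) bezout)
    neg-square : ∀ r → - r * - r ≡ r * r
    neg-square = solve-∀
    simplify : ∀ r a b → (+ 0 + - r) * a + - + 0 * b ≡ - r * a
    simplify = solve-∀
  Y-block {h = h} (step {t} {ts} nz rest) {p} {r} {x} {y} qr≡p bezout blk with Block-step blk
  ... | h′ , blk′ , Y-step with Y-block rest {(+ 2 + - + t) * p + - r} {p} {ℤ.- y} {x + y * (+ 2 + - + t)}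
                                  (fraction-step t nz qr≡p) (trans (regroup x y p r (+ 2 + - + t)) bezout) blk′
    where
    regroup : ∀ x y p r t → - y * (t * p + - r) + (x + y * t) * p ≡ x * p + y * r
    regroup = solve-∀
  ... | σ , σσ≡1 , Y≡ = σ , σσ≡1 , λ n →
    trans (cong (λ k → Y p r k h) (ℕP.+-assoc t (sum ts) n)) (trans (Y-step p r (sum ts ℕ.+ n)) (Y≡ n))

  A₁-primitive-block : ∀ {ts h e} → Primitive ts → bad (suc h) ≡ true → Block (suc h) ts e →
    Σ ℤ λ σ → (σ * σ ≡ + 1) × (∀ n → A₁ (sum ts ℕ.+ n) h ≡ σ * A n e)
  A₁-primitive-block {h = h} (prim {t} {ts} _ prim-from) b blk with Block-step blk
  -- After the first entry the denominator is 1, so `0` and `1` serve as Bézout coefficients.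
  ... | h′ , blk′ , Y-step with Y-block prim-from {(+ 2 + - + t) * + 1 + - + 0} {+ 1} {+ 0} {+ 1}
                                  (fraction-start t) refl blk′
  ... | σ , σσ≡1 , Y≡ = σ , σσ≡1 , λ n → begin
    A₁ (t ℕ.+ sum ts ℕ.+ n) h
      ≡⟨ cong (λ k → A₁ k h) (ℕP.+-assoc t (sum ts) n) ⟩
    A₁ (N n) h
      ≡⟨ A₁-bad (N n) h b ⟩
    A (N n) (suc h) + - + 1 * B (N n) (suc h)
      ≡⟨ pad (A (N n) (suc h)) (B (N n) (suc h)) ⟩
    Y (+ 1) (+ 0) (N n) (suc h)
      ≡⟨ trans (Y-step (+ 1) (+ 0) (sum ts ℕ.+ n)) (Y≡ n) ⟩
    σ * A n _ ∎
    where
    N : ℕ → ℕ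
    N n = t ℕ.+ (sum ts ℕ.+ n)
    pad : ∀ a b → a + - + 1 * b ≡ (+ 1 + - + 0) * a + - + 1 * b
    pad = solve-∀

  -- S r n h interleaves the determinants: climbing d levels lowers r by d.
  S : ℕ → ℕ → ℕ → ℤ
  S zero          n h = A n h
  S (suc zero)    n h = A₁ n h
  S (suc (suc r)) n h = S r (suc n) h

  S-double : ∀ s r n h → S (double s ℕ.+ r) n h ≡ S r (s ℕ.+ n) h
  S-double zero    r n h = refl
  S-double (suc s) r n h = trans (S-double s r (suc n) h) (cong (λ k → S r k h) (ℕP.+-suc s n))

  S-good : ∀ {h} → bad (suc h) ≡ false → ∀ r n → S (suc r) n h ≡ S r n (suc h)
  S-good {h} g zero          n = A₁-good n h g
  S-good {h} g (suc zero)    n = A-suc n h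
  S-good {h} g (suc (suc r)) n = S-good g r (suc n)

  -- The sign may depend on the parity of the remaining index, because a block treats plain and
  -- shifted determinants differently. It does not depend on `n`.
  record Link (h e : ℕ) : Set where
    constructor link
    field
      distance : ℕ
      arrival  : e ≡ distance ℕ.+ h
      σ        : ℕ → ℤ
      σ-parity : ∀ r → σ (suc (suc r)) ≡ σ r
      σ-unit   : ∀ r → σ r * σ r ≡ + 1
      connect  : ∀ r n → S (distance ℕ.+ r) n h ≡ σ r * S r n e

  Link-refl : ∀ {h} → Link h h
  Link-refl {h} = link 0 refl (λ _ → + 1) (λ _ → refl) (λ _ → refl) λ r n → sym (*-identityˡ (S r n h))

  periodic-double : ∀ {σ : ℕ → ℤ} → (∀ r → σ (suc (suc r)) ≡ σ r) → ∀ d r → σ (d ℕ.+ suc (suc r)) ≡ σ (d ℕ.+ r)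
  periodic-double {σ} per d r = trans (cong σ (trans (ℕP.+-suc d (suc r)) (cong suc (ℕP.+-suc d r)))) (per (d ℕ.+ r))

  Link-trans : ∀ {h e e′} → Link h e → Link e e′ → Link h e′
  Link-trans {h} {e} {e′} (link d refl σ σ-par σ-unit conn) (link d′ refl σ′ σ′-par σ′-unit conn′) =
    link (d ℕ.+ d′) end (λ r → σ (d′ ℕ.+ r) * σ′ r)
      (λ r → cong₂ _*_ (periodic-double {σ} σ-par d′ r) (σ′-par r))
      (λ r → trans (interchange (σ (d′ ℕ.+ r)) (σ′ r)) (cong₂ _*_ (σ-unit (d′ ℕ.+ r)) (σ′-unit r)))
      λ r n → begin
        S (d ℕ.+ d′ ℕ.+ r) n h
          ≡⟨ cong (λ k → S k n h) (ℕP.+-assoc d d′ r) ⟩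
        S (d ℕ.+ (d′ ℕ.+ r)) n h
          ≡⟨ conn (d′ ℕ.+ r) n ⟩
        σ (d′ ℕ.+ r) * S (d′ ℕ.+ r) n e
          ≡⟨ cong (λ z → σ (d′ ℕ.+ r) * z) (conn′ r n) ⟩
        σ (d′ ℕ.+ r) * (σ′ r * S r n e′)
          ≡⟨ ℤP.*-assoc (σ (d′ ℕ.+ r)) (σ′ r) (S r n e′) ⟨
        σ (d′ ℕ.+ r) * σ′ r * S r n e′ ∎
    where
    interchange : ∀ x y → x * y * (x * y) ≡ x * x * (y * y)
    interchange = solve-∀
    end : d′ ℕ.+ (d ℕ.+ h) ≡ d ℕ.+ d′ ℕ.+ h
    end = trans (sym (ℕP.+-assoc d′ d h)) (cong (ℕ._+ h) (ℕP.+-comm d′ d))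

  Link-good : ∀ {h} → bad (suc h) ≡ false → Link h (suc h)
  Link-good {h} g = link 1 refl (λ _ → + 1) (λ _ → refl) (λ _ → refl)
    λ r n → trans (S-good g r n) (sym (*-identityˡ (S r n (suc h))))

  -- For even `r` shifted determinants below the block become plain ones above it, with the sign
  -- given by the primitive sequence. For odd `r` plain ones become shifted ones, and these cross
  -- the block without a sign.
  Link-block : ∀ {h ts e} → bad (suc h) ≡ true → Primitive ts → Block (suc h) ts e → Link h e
  Link-block {h} {ts} {e} b isPrim blk with A₁-primitive-block isPrim b blk
  ... | τ , ττ≡1 , A₁≡ =
    link (suc (double s)) (trans (Block-end blk) (ℕP.+-suc (double s) h)) σ (λ _ → refl) unit
      λ r n → trans (trans (cong (λ k → S k n h) (sym (ℕP.+-suc (double s) r))) (S-double s (suc r) n h))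
                    (connect r n)
    where
    s : ℕ
    s = sum ts
    σ : ℕ → ℤ
    σ zero          = τ
    σ (suc zero)    = + 1
    σ (suc (suc r)) = σ r
    unit : ∀ r → σ r * σ r ≡ + 1
    unit zero          = ττ≡1
    unit (suc zero)    = refl
    unit (suc (suc r)) = unit r
    connect : ∀ r n → S (suc r) (s ℕ.+ n) h ≡ σ r * S r n e
    connect zero          n = A₁≡ n
    connect (suc zero)    n = trans (A-suc (s ℕ.+ n) h) (trans (A₁-block blk n) (sym (*-identityˡ (A₁ n e))))
    connect (suc (suc r)) n = trans (cong (λ k → S (suc r) k h) (sym (ℕP.+-suc s n))) (connect r (suc n))

  data Climb : ℕ → ℕ → Set where
    here  : ∀ {h} → Climb h h
    good  : ∀ {h e} → bad (suc h) ≡ false → Climb (suc h) e → Climb h e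
    block : ∀ {h ts e e′} → bad (suc h) ≡ true → Primitive ts → Block (suc h) ts e → Climb e e′ → Climb h e′

  Climb⇒Link : ∀ {h e} → Climb h e → Link h e
  Climb⇒Link here                 = Link-refl
  Climb⇒Link (good g c)           = Link-trans (Link-good g) (Climb⇒Link c)
  Climb⇒Link (block b isPrim blk c) = Link-trans (Link-block b isPrim blk) (Climb⇒Link c)

  S-cong : ∀ {h h′} → (∀ k → f h k ≡ f h′ k) → ∀ r n → S r n h ≡ S r n h′
  S-cong e zero          n = hankel-cong n e
  S-cong e (suc zero)    n = hankel-cong n (λ k → e (suc k))
  S-cong e (suc (suc r)) n = S-cong e r (suc n)

  -- Two rounds return to the same parity with a sign depending on it only, four rounds to the same sign.
  hankel-periodic : ∀ m → (∀ k → f m k ≡ f 0 k) → Climb 0 m → ∀ n → A (m ℕ.+ m ℕ.+ n) 0 ≡ A n 0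
  hankel-periodic m f-per climb n with Climb⇒Link climb
  ... | link d end σ σ-par σ-unit conn with trans end (ℕP.+-identityʳ d)
  ... | refl = begin
    A (m ℕ.+ m ℕ.+ n) 0
      ≡⟨ S-double (m ℕ.+ m) 0 n 0 ⟨
    S (double (m ℕ.+ m) ℕ.+ 0) n 0
      ≡⟨ cong (λ k → S k n 0) four ⟩
    S (m ℕ.+ (m ℕ.+ (m ℕ.+ (m ℕ.+ 0)))) n 0
      ≡⟨ trans (round (m ℕ.+ (m ℕ.+ (m ℕ.+ 0)))) (cong (λ z → σ (m ℕ.+ (m ℕ.+ (m ℕ.+ 0))) * z)
          (trans (round (m ℕ.+ (m ℕ.+ 0))) (cong (λ z → σ (m ℕ.+ (m ℕ.+ 0)) * z)
            (trans (round (m ℕ.+ 0)) (cong (λ z → σ (m ℕ.+ 0) * z) (round 0)))))) ⟩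
    σ (m ℕ.+ (m ℕ.+ (m ℕ.+ 0))) * (σ (m ℕ.+ (m ℕ.+ 0)) * (σ (m ℕ.+ 0) * (σ 0 * A n 0)))
      ≡⟨ cong₂ (λ x y → x * (y * (σ (m ℕ.+ 0) * (σ 0 * A n 0)))) (twice (m ℕ.+ 0)) (twice 0) ⟩
    σ (m ℕ.+ 0) * (σ 0 * (σ (m ℕ.+ 0) * (σ 0 * A n 0)))
      ≡⟨ regroup (σ (m ℕ.+ 0)) (σ 0) (A n 0) ⟩
    σ (m ℕ.+ 0) * σ (m ℕ.+ 0) * (σ 0 * σ 0) * A n 0
      ≡⟨ cong₂ (λ x y → x * y * A n 0) (σ-unit (m ℕ.+ 0)) (σ-unit 0) ⟩
    + 1 * + 1 * A n 0
      ≡⟨ *-identityˡ (A n 0) ⟩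
    A n 0 ∎
    where
    round : ∀ r → S (m ℕ.+ r) n 0 ≡ σ r * S r n 0
    round r = trans (conn r n) (cong (λ z → σ r * z) (S-cong f-per r n))
    regroup : ∀ x y a → x * (y * (x * (y * a))) ≡ x * x * (y * y) * a
    regroup = solve-∀
    twice : ∀ r → σ (m ℕ.+ (m ℕ.+ r)) ≡ σ r
    twice r = trans (cong σ (trans (sym (ℕP.+-assoc m m r)) (cong (ℕ._+ r) (sym (double≡+ m))))) (even m)
      where
      even : ∀ k → σ (double k ℕ.+ r) ≡ σ r
      even zero    = refl
      even (suc k) = trans (σ-par (double k ℕ.+ r)) (even k)
    four : double (m ℕ.+ m) ℕ.+ 0 ≡ m ℕ.+ (m ℕ.+ (m ℕ.+ (m ℕ.+ 0)))
    four = trans (cong (ℕ._+ 0) (double≡+ (m ℕ.+ m)))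
      (trans (ℕP.+-assoc (m ℕ.+ m) (m ℕ.+ m) 0) (trans (ℕP.+-assoc m m _) (cong (λ k → m ℕ.+ (m ℕ.+ k)) (ℕP.+-assoc m m 0))))

-- Counting Dyck paths

count : {X : Set} → (X → Bool) → List X → ℤ
count P []       = + 0
count P (x ∷ xs) = ε (P x) + count P xs

length-filterᵇ : ∀ {X : Set} (P : X → Bool) xs → + length (filterᵇ P xs) ≡ count P xs
length-filterᵇ P []       = refl
length-filterᵇ P (x ∷ xs) with P x
... | true  = cong (λ z → + 1 + z) (length-filterᵇ P xs)
... | false = trans (length-filterᵇ P xs) (sym (+-identityˡ (count P xs)))

count-cong : ∀ {X : Set} {P Q : X → Bool} → (∀ x → P x ≡ Q x) → ∀ xs → count P xs ≡ count Q xs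
count-cong e []       = refl
count-cong e (x ∷ xs) = cong₂ _+_ (cong ε (e x)) (count-cong e xs)

count-false : ∀ {X : Set} (xs : List X) → count (λ _ → false) xs ≡ + 0
count-false []       = refl
count-false (x ∷ xs) = trans (+-identityˡ (count (λ _ → false) xs)) (count-false xs)

count-∧ : ∀ {X : Set} b (P : X → Bool) xs → count (λ x → b ∧ P x) xs ≡ ε b * count P xs
count-∧ true  P xs = sym (*-identityˡ (count P xs))
count-∧ false P xs = count-false xs

count-words : ∀ P n → count P (words (suc n)) ≡
  count (λ w → P (U ∷ w)) (words n) + count (λ w → P (D ∷ w)) (words n)
count-words P n = split (words n)
  where
  interchange : ∀ a b c d → a + (b + (c + d)) ≡ a + c + (b + d)
  interchange = solve-∀
  split : ∀ ws → count P (concatMap (λ w → (U ∷ w) ∷ (D ∷ w) ∷ []) ws) ≡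
    count (λ w → P (U ∷ w)) ws + count (λ w → P (D ∷ w)) ws
  split []       = refl
  split (w ∷ ws) = trans (cong (λ z → ε (P (U ∷ w)) + (ε (P (D ∷ w)) + z)) (split ws))
    (interchange (ε (P (U ∷ w))) (ε (P (D ∷ w))) (count (λ w → P (U ∷ w)) ws) (count (λ w → P (D ∷ w)) ws))

-- N bad h ℓ counts the words of length ℓ leading from height h to 0, and N↑ bad h ℓ
-- those of length ℓ + 1 among them that start with an up-step.
N N↑ : (ℕ → Bool) → ℕ → ℕ → ℤ
N  bad h ℓ = count (validDyck bad h) (words ℓ)
N↑ bad h ℓ = count (λ w → validDyck bad h (U ∷ w)) (words ℓ)

N-suc₀ : ∀ bad ℓ → N bad 0 (suc ℓ) ≡ N↑ bad 0 ℓ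
N-suc₀ bad ℓ = trans (count-words (validDyck bad 0) ℓ)
  (trans (cong (λ z → N↑ bad 0 ℓ + z) (count-false (words ℓ))) (+-identityʳ (N↑ bad 0 ℓ)))

N-suc : ∀ bad h ℓ → N bad (suc h) (suc ℓ) ≡ N↑ bad (suc h) ℓ + N bad h ℓ
N-suc bad h ℓ = count-words (validDyck bad (suc h)) ℓ

N↑-suc : ∀ bad h ℓ → N↑ bad h (suc ℓ) ≡ N↑ bad (suc h) ℓ + ε (not (bad (suc h))) * N bad h ℓ
N↑-suc bad h ℓ = trans (count-words (λ w → validDyck bad h (U ∷ w)) ℓ)
  (cong (λ z → N↑ bad (suc h) ℓ + z) (count-∧ (not (bad (suc h))) (validDyck bad h) (words ℓ)))

-- Splitting a path from height h + 1 at its first visit to height 0.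
N-first-passage : ∀ bad ℓ h →
  (N bad (suc h) (suc ℓ) ≡ (N bad 0 ⋆ N (bad ∘ suc) h) ℓ) ×
  (N↑ bad (suc h) (suc ℓ) ≡ (N bad 0 ⋆ N↑ (bad ∘ suc) h) ℓ)
N-first-passage bad zero h = trans (N-suc bad h 0) (start h) , trans (N↑-suc bad (suc h) 0) (*-zeroʳ⁺ (ε (not (bad (suc (suc h))))))
  where
  start : ∀ h → N↑ bad (suc h) 0 + N bad h 0 ≡ N bad 0 0 * N (bad ∘ suc) h 0
  start zero    = refl
  start (suc h) = refl
  *-zeroʳ⁺ : ∀ x → + 0 + x * + 0 ≡ + 1 * + 0
  *-zeroʳ⁺ = solve-∀
N-first-passage bad (suc ℓ) h = total h , up
  where
  N₀ N′ N↑′ : ℕ → ℤ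
  N₀  = N bad 0
  N′  = N (bad ∘ suc) h
  N↑′ = N↑ (bad ∘ suc) h

  ↑-conv : (N₀ ⋆ N↑′) (suc ℓ) ≡ (N₀ ⋆ (N↑′ ∘ suc)) ℓ
  ↑-conv = trans (cong (λ z → z + (N₀ ⋆ (N↑′ ∘ suc)) ℓ) (*-zeroʳ (N₀ (suc ℓ)))) (+-identityˡ _)

  up : N↑ bad (suc h) (suc (suc ℓ)) ≡ (N₀ ⋆ N↑′) (suc ℓ)
  up = begin
    N↑ bad (suc h) (suc (suc ℓ))
      ≡⟨ N↑-suc bad (suc h) (suc ℓ) ⟩
    N↑ bad (suc (suc h)) (suc ℓ) + c * N bad (suc h) (suc ℓ)
      ≡⟨ cong₂ (λ x y → x + c * y) (proj₂ (N-first-passage bad ℓ (suc h))) (proj₁ (N-first-passage bad ℓ h)) ⟩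
    (N₀ ⋆ N↑ (bad ∘ suc) (suc h)) ℓ + c * (N₀ ⋆ N′) ℓ
      ≡⟨ ⋆-linear N₀ c (N↑ (bad ∘ suc) (suc h)) N′ ℓ ⟨
    (N₀ ⋆ (λ k → N↑ (bad ∘ suc) (suc h) k + c * N′ k)) ℓ
      ≡⟨ ⋆-congʳ N₀ (λ k → sym (N↑-suc (bad ∘ suc) h k)) ℓ ⟩
    (N₀ ⋆ (N↑′ ∘ suc)) ℓ
      ≡⟨ ↑-conv ⟨
    (N₀ ⋆ N↑′) (suc ℓ) ∎
    where
    c : ℤ
    c = ε (not (bad (suc (suc h))))

  total : ∀ h → N bad (suc h) (suc (suc ℓ)) ≡ (N₀ ⋆ N (bad ∘ suc) h) (suc ℓ)
  total zero = begin
    N bad 1 (suc (suc ℓ))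
      ≡⟨ N-suc bad 0 (suc ℓ) ⟩
    N↑ bad 1 (suc ℓ) + N₀ (suc ℓ)
      ≡⟨ cong (λ z → z + N₀ (suc ℓ)) (proj₂ (N-first-passage bad ℓ 0)) ⟩
    (N₀ ⋆ N↑ (bad ∘ suc) 0) ℓ + N₀ (suc ℓ)
      ≡⟨ swap ((N₀ ⋆ N↑ (bad ∘ suc) 0) ℓ) (N₀ (suc ℓ)) ⟩
    N₀ (suc ℓ) * + 1 + (N₀ ⋆ N↑ (bad ∘ suc) 0) ℓ
      ≡⟨ cong (λ z → N₀ (suc ℓ) * + 1 + z) (⋆-congʳ N₀ (λ k → sym (N-suc₀ (bad ∘ suc) k)) ℓ) ⟩
    N₀ (suc ℓ) * + 1 + (N₀ ⋆ (N (bad ∘ suc) 0 ∘ suc)) ℓ ∎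
    where
    swap : ∀ x y → x + y ≡ y * + 1 + x
    swap = solve-∀
  total (suc h) = begin
    N bad (suc (suc h)) (suc (suc ℓ))
      ≡⟨ N-suc bad (suc h) (suc ℓ) ⟩
    N↑ bad (suc (suc h)) (suc ℓ) + N bad (suc h) (suc ℓ)
      ≡⟨ cong₂ _+_ (proj₂ (N-first-passage bad ℓ (suc h))) (proj₁ (N-first-passage bad ℓ h)) ⟩
    (N₀ ⋆ N↑ (bad ∘ suc) (suc h)) ℓ + (N₀ ⋆ N (bad ∘ suc) h) ℓ
      ≡⟨ pad (N₀ (suc ℓ)) ((N₀ ⋆ N↑ (bad ∘ suc) (suc h)) ℓ) ((N₀ ⋆ N (bad ∘ suc) h) ℓ) ⟩
    N₀ (suc ℓ) * + 0 + ((N₀ ⋆ N↑ (bad ∘ suc) (suc h)) ℓ + + 1 * (N₀ ⋆ N (bad ∘ suc) h) ℓ)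
      ≡⟨ cong (λ z → N₀ (suc ℓ) * + 0 + z) (trans
           (sym (⋆-linear N₀ (+ 1) (N↑ (bad ∘ suc) (suc h)) (N (bad ∘ suc) h) ℓ))
           (⋆-congʳ N₀ (λ k → trans (cong (λ z → N↑ (bad ∘ suc) (suc h) k + z) (*-identityˡ (N (bad ∘ suc) h k)))
                                    (sym (N-suc (bad ∘ suc) h k))) ℓ)) ⟩
    N₀ (suc ℓ) * + 0 + (N₀ ⋆ (N (bad ∘ suc) (suc h) ∘ suc)) ℓ ∎
    where
    pad : ∀ x y z → y + z ≡ x * + 0 + (y + + 1 * z)
    pad = solve-∀

-- After the initial up-step the path continues from height 1. A continuation that starts with a
-- down-step completes a peak at height 1 which `N bad 1` does not see, hence the correction term.
N-first-return : ∀ bad ℓ →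
  N bad 0 (suc (suc ℓ)) ≡ (N bad 0 ⋆ N (bad ∘ suc) 0) ℓ + - ε (bad 1) * N bad 0 ℓ
N-first-return bad ℓ = begin
  N bad 0 (suc (suc ℓ))
    ≡⟨ trans (N-suc₀ bad (suc ℓ)) (N↑-suc bad 0 ℓ) ⟩
  N↑ bad 1 ℓ + ε (not (bad 1)) * N bad 0 ℓ
    ≡⟨ complement (bad 1) (N↑ bad 1 ℓ) (N bad 0 ℓ) ⟩
  N↑ bad 1 ℓ + N bad 0 ℓ + - ε (bad 1) * N bad 0 ℓ
    ≡⟨ cong (λ z → z + - ε (bad 1) * N bad 0 ℓ) (trans (sym (N-suc bad 0 ℓ)) (proj₁ (N-first-passage bad ℓ 0))) ⟩
  (N bad 0 ⋆ N (bad ∘ suc) 0) ℓ + - ε (bad 1) * N bad 0 ℓ ∎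
  where
  complement : ∀ b x y → x + ε (not b) * y ≡ x + y + - ε b * y
  complement true  = when-bad
    where
    when-bad : ∀ x y → x + + 0 * y ≡ x + y + - + 1 * y
    when-bad = solve-∀
  complement false = when-good
    where
    when-good : ∀ x y → x + + 1 * y ≡ x + y + - + 0 * y
    when-good = solve-∀

-- Passes from counting by length to counting by size: multiplying by a series in `x²` commutes with
-- taking even parts.
⋆-even : ∀ f a → (∀ n → f (suc (double n)) ≡ + 0) → ∀ n → (f ⋆ a) (double n) ≡ ((f ∘ double) ⋆ (a ∘ double)) n
⋆-even f a odd zero    = refl
⋆-even f a odd (suc n) = cong (λ z → f (double (suc n)) * a 0 + z) (trans
  (cong₂ (λ x y → x * a 1 + y) (odd n) (⋆-even f (λ k → a (suc (suc k))) odd n))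
  (+-identityˡ (((f ∘ double) ⋆ (λ k → a (suc (suc (double k))))) n)))

N-odd : ∀ bad ℓ h n → h ℕ.+ ℓ ≡ suc (double n) → N bad h ℓ ≡ + 0
N↑-even : ∀ bad ℓ h n → h ℕ.+ ℓ ≡ double n → N↑ bad h ℓ ≡ + 0

N-odd bad zero    (suc h) n       e = refl
N-odd bad (suc ℓ) zero    n       e = trans (N-suc₀ bad ℓ) (N↑-even bad ℓ 0 n (ℕP.suc-injective e))
N-odd bad (suc ℓ) (suc h) zero    e with trans (sym (ℕP.+-suc h ℓ)) (ℕP.suc-injective e)
... | ()
N-odd bad (suc ℓ) (suc h) (suc n) e = trans (N-suc bad h ℓ) (cong₂ _+_
  (N↑-even bad ℓ (suc h) (suc n) e′) (N-odd bad ℓ h n (ℕP.suc-injective e′)))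
  where
  e′ : suc (h ℕ.+ ℓ) ≡ double (suc n)
  e′ = trans (sym (ℕP.+-suc h ℓ)) (ℕP.suc-injective e)

N↑-even bad zero    h n       e = refl
N↑-even bad (suc ℓ) h zero    e with trans (sym (ℕP.+-suc h ℓ)) e
... | ()
N↑-even bad (suc ℓ) h (suc n) e = trans (N↑-suc bad h ℓ) (trans
  (cong₂ (λ x y → x + ε (not (bad (suc h))) * y)
    (N↑-even bad ℓ (suc h) (suc n) e′) (N-odd bad ℓ h n (ℕP.suc-injective e′)))
  (trans (+-identityˡ (ε (not (bad (suc h))) * + 0)) (*-zeroʳ (ε (not (bad (suc h)))))))
  where
  e′ : suc (h ℕ.+ ℓ) ≡ double (suc n)
  e′ = trans (sym (ℕP.+-suc h ℓ)) e

dyckSeries : (ℕ → Bool) → ℕ → ℤ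
dyckSeries bad n = N bad 0 (double n)

dyckSeries-unfold : ∀ bad →
  dyckSeries bad ≗1/1-x (λ k → dyckSeries (bad ∘ suc) k + - ε (bad 1) * δ k)
dyckSeries-unfold bad = refl , λ n → begin
  N bad 0 (suc (suc (double n)))
    ≡⟨ N-first-return bad (double n) ⟩
  (N bad 0 ⋆ N (bad ∘ suc) 0) (double n) + c * f n
    ≡⟨ cong₂ (λ x y → x + c * y) (⋆-even (N bad 0) (N (bad ∘ suc) 0) (λ n → N-odd bad (suc (double n)) 0 n refl) n)
                                 (sym (⋆-identityʳ f n)) ⟩
  (f ⋆ dyckSeries (bad ∘ suc)) n + c * (f ⋆ δ) n
    ≡⟨ ⋆-linear f c (dyckSeries (bad ∘ suc)) δ n ⟨
  (f ⋆ (λ k → dyckSeries (bad ∘ suc) k + c * δ k)) n ∎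
  where
  c : ℤ
  c = - ε (bad 1)
  f : ℕ → ℤ
  f = dyckSeries bad

validDyck-cong : ∀ {bad bad′} → (∀ x → bad x ≡ bad′ x) → ∀ h w → validDyck bad h w ≡ validDyck bad′ h w
validDyck-cong e h       []          = refl
validDyck-cong e h       (U ∷ [])    = refl
validDyck-cong e h       (U ∷ D ∷ w) = cong₂ (λ b v → not b ∧ v) (e (suc h)) (validDyck-cong e h w)
validDyck-cong e h       (U ∷ U ∷ w) = validDyck-cong e (suc h) (U ∷ w)
validDyck-cong e zero    (D ∷ w)     = refl
validDyck-cong e (suc h) (D ∷ w)     = validDyck-cong e h w

dyckSeries-cong : ∀ {bad bad′} → (∀ x → bad x ≡ bad′ x) → ∀ n → dyckSeries bad n ≡ dyckSeries bad′ n
dyckSeries-cong e n = count-cong (validDyck-cong e 0) (words (double n))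

dyckCount≡dyckSeries : ∀ m V n → + dyckCount m V n ≡ dyckSeries (inMV m V) n
dyckCount≡dyckSeries m V n = trans (length-filterᵇ (validDyck (inMV m V) 0) (words (2 ℕ.* n)))
  (cong (λ k → count (validDyck (inMV m V) 0) (words k))
    (trans (cong (λ k → n ℕ.+ k) (ℕP.+-identityʳ n)) (sym (double≡+ n))))

levelSeries : (ℕ → Bool) → ℕ → ℕ → ℤ
levelSeries bad h = dyckSeries (λ x → bad (h ℕ.+ x))

levelSeries-unfold : ∀ bad h →
  levelSeries bad h ≗1/1-x (λ k → levelSeries bad (suc h) k + - ε (bad (suc h)) * δ k)
levelSeries-unfold bad h with dyckSeries-unfold (λ x → bad (h ℕ.+ x))
... | start , rec = start , λ n → trans (rec n) (⋆-congʳ (levelSeries bad h)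
  (λ k → cong₂ (λ x b → x + - ε b * δ k)
    (dyckSeries-cong (λ x → cong bad (ℕP.+-suc h x)) k)
    (cong bad (ℕP.+-comm h 1))) n)

-- Forbidden heights

any-∈ : ∀ {X : Set} {p : X → Bool} {x xs} → x ∈ xs → p x ≡ true → any p xs ≡ true
any-∈ {p = p} (here refl) e rewrite e = refl
any-∈ {p = p} {xs = y ∷ ys} (there x∈) e with p y
... | true  = refl
... | false = any-∈ x∈ e

any-witness : ∀ {X : Set} {p : X → Bool} xs → any p xs ≡ true → Σ X λ x → x ∈ xs × p x ≡ true
any-witness {p = p} (x ∷ xs) e with p x in px
... | true = x , here refl , px
... | false with any-witness xs e
... | y , y∈ , py = y , there y∈ , py

any-cong : ∀ {X : Set} {p q : X → Bool} → (∀ x → p x ≡ q x) → ∀ xs → any p xs ≡ any q xs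
any-cong e []       = refl
any-cong e (x ∷ xs) = cong₂ _∨_ (e x) (any-cong e xs)

inMV-periodic : ∀ m V x → inMV m V (m ℕ.+ x) ≡ inMV m V x
inMV-periodic m V x = any-cong same V
  where
  same : ∀ j → ⌊ (+ m) ∣? (+ (m ℕ.+ x) ℤ.- j) ⌋ ≡ ⌊ (+ m) ∣? (+ x ℤ.- j) ⌋
  same j with (+ m) ∣? (+ (m ℕ.+ x) ℤ.- j) | (+ m) ∣? (+ x ℤ.- j)
  ... | yes _  | yes _  = refl
  ... | no  _  | no  _  = refl
  ... | yes d  | no ¬d = ⊥-elim (¬d (∣m+n∣m⇒∣n (subst (+ m ∣_) (ℤP.+-assoc (+ m) (+ x) (- j)) d) ∣-refl))
  ... | no ¬d  | yes d = ⊥-elim (¬d (subst (+ m ∣_) (sym (ℤP.+-assoc (+ m) (+ x) (- j))) (∣m∣n⇒∣m+n ∣-refl d)))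

∈⇒inMV : ∀ m {R x} → x ∈ R → inMV m (map +_ R) x ≡ true
∈⇒inMV m {R} {x} x∈R = any-∈ (∈-map⁺ +_ x∈R) divisible
  where
  divisible : ⌊ (+ m) ∣? (+ x ℤ.- + x) ⌋ ≡ true
  divisible with (+ m) ∣? (+ x ℤ.- + x)
  ... | yes _ = refl
  ... | no ¬d = ⊥-elim (¬d (divides (+ 0) (ℤP.+-inverseʳ (+ x))))

difference-small : ∀ {m x y} → 1 ℕ.≤ x → x ℕ.≤ m → 1 ℕ.≤ y → y ℕ.≤ m → ℤ.∣ + x ℤ.- + y ∣ ℕ.< m
difference-small {m} {x} {y} 1≤x x≤m 1≤y y≤m rewrite ℤP.m-n≡m⊖n x y with ℕP.≤-total x y
... | inj₁ x≤y rewrite ℤP.∣⊖∣-≤ x≤y = ℕP.<-≤-trans (ℕP.∸-monoʳ-< 1≤x x≤y) y≤m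
... | inj₂ y≤x rewrite ℤP.∣m⊖n∣≡∣n⊖m∣ x y | ℤP.∣⊖∣-≤ y≤x = ℕP.<-≤-trans (ℕP.∸-monoʳ-< 1≤y y≤x) x≤m

-- Two integers between 1 and `m` differ by less than `m`, so a congruence modulo `m` between them
-- is an equality.
inMV⇒∈ : ∀ {m R x} → All (1 ℕ.≤_) R → All (ℕ._≤ m) R → 1 ℕ.≤ x → x ℕ.≤ m → inMV m (map +_ R) x ≡ true → x ∈ R
inMV⇒∈ {m} {R} {x} R≥1 R≤m 1≤x x≤m e with any-witness (map +_ R) e
... | j , j∈ , dj with ∈-map⁻ +_ j∈
... | y , y∈R , refl with (+ m) ∣? (+ x ℤ.- + y)
... | yes d = subst (_∈ R) (sym x≡y) y∈R
  where
  small : ℤ.∣ + x ℤ.- + y ∣ ℕ.< m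
  small = difference-small 1≤x x≤m (All.lookup R≥1 y∈R) (All.lookup R≤m y∈R)
  zero-diff : ∀ {d} → d ℕ.< m → m ℕD.∣ d → d ≡ 0
  zero-diff {zero}  d<m m∣d = refl
  zero-diff {suc d} d<m m∣d = ⊥-elim (ℕP.<⇒≱ d<m (ℕD.∣⇒≤ m∣d))
  x≡y : x ≡ y
  x≡y = ℤP.+-injective (ℤP.i-j≡0⇒i≡j (+ x) (+ y) (ℤP.∣i∣≡0⇒i≡0 (zero-diff small (∣⇒∣ᵤ d))))
... | no _ with dj
... | ()

-- The heights of the blocks within one period

up : ℕ → ℕ → ℕ
up zero    h = h
up (suc t) h = up t (suc (suc h))

-- Since `up t h` is `h + 2 t`, these are the forbidden heights of a block after its first one, `h`.
-- The recursion of `up` moves the start, as the constructors of `Block` do.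
after : ℕ → List ℕ → List ℕ
after h []       = []
after h (t ∷ ts) = up t h ∷ after (up t h) ts

end : ℕ → List ℕ → ℕ
end h []       = h
end h (t ∷ ts) = end (up t h) ts

up-≥ : ∀ t h → h ℕ.≤ up t h
up-≥ zero    h = ℕP.≤-refl
up-≥ (suc t) h = ℕP.≤-trans (ℕP.≤-trans (ℕP.n≤1+n h) (ℕP.n≤1+n (suc h))) (up-≥ t (suc (suc h)))

end-≥ : ∀ h ts → h ℕ.≤ end h ts
end-≥ h []       = ℕP.≤-refl
end-≥ h (t ∷ ts) = ℕP.≤-trans (up-≥ t h) (end-≥ (up t h) ts)

after-≥ : ∀ h ts → All (h ℕ.≤_) (after h ts)
after-≥ h []       = []
after-≥ h (t ∷ ts) = up-≥ t h ∷ All.map (ℕP.≤-trans (up-≥ t h)) (after-≥ (up t h) ts)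

after-≤ : ∀ h ts → All (ℕ._≤ end h ts) (after h ts)
after-≤ h []       = []
after-≤ h (t ∷ ts) = end-≥ (up t h) ts ∷ after-≤ (up t h) ts

end-∈ : ∀ h ts → end h ts ∈ h ∷ after h ts
end-∈ h []       = here refl
end-∈ h (t ∷ ts) = there (end-∈ (up t h) ts)

-- The first height of a block is `2 + k_j`, which is `suc a` for `a = k_j + 1`. With `h` the last
-- height of the block before, or 0, the bound `h ≤ a` is the assumption on `k_j`.
data Layout (m : ℕ) : ℕ → List ℕ → Set where
  nil  : ∀ {h} → h ℕ.≤ m → Layout m h []
  cons : ∀ {h a ts R} → h ℕ.≤ a → Primitive ts → end (suc a) ts ℕ.≤ m →
         Layout m (end (suc a) ts) R → Layout m h (suc a ∷ after (suc a) ts ++ R)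

Layout-> : ∀ {m h R} → Layout m h R → All (h ℕ.<_) R
Layout-> (nil _) = []
Layout-> {h = h} (cons {a = a} {ts = ts} h≤a _ _ L) = s≤s h≤a ∷ ++⁺
  (All.map (ℕP.≤-trans (s≤s h≤a)) (after-≥ (suc a) ts))
  (All.map (λ e<x → ℕP.≤-trans (s≤s h≤a) (ℕP.≤-trans (end-≥ (suc a) ts) (ℕP.<⇒≤ e<x))) (Layout-> L))

Layout-≤ : ∀ {m h R} → Layout m h R → All (ℕ._≤ m) R
Layout-≤ (nil _) = []
Layout-≤ (cons {a = a} {ts = ts} _ _ e≤m L) = ℕP.≤-trans (end-≥ (suc a) ts) e≤m ∷ ++⁺
  (All.map (λ x≤e → ℕP.≤-trans x≤e e≤m) (after-≤ (suc a) ts)) (Layout-≤ L)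

module Climbing (m : ℕ) (bad : ℕ → Bool) where
  open Levels bad (levelSeries bad) (levelSeries-unfold bad)

  -- Restricting to heights above `h` allows the list to be consumed from below while `bad` stays
  -- the same function.
  Above : ℕ → List ℕ → Set
  Above h R = ∀ x → h ℕ.< x → x ℕ.≤ m → (bad x ≡ true → x ∈ R) × (x ∈ R → bad x ≡ true)

  Above-mono : ∀ {h h′ R} → h ℕ.≤ h′ → Above h R → Above h′ R
  Above-mono h≤h′ ab x h′<x = ab x (ℕP.≤-<-trans h≤h′ h′<x)

  Above-drop : ∀ {h y R} → h ℕ.≤ y → Above h (y ∷ R) → Above y R
  Above-drop {y = y} {R} h≤y ab x y<x x≤m = forward , backward
    where
    forward : bad x ≡ true → x ∈ R
    forward b with proj₁ (ab x (ℕP.≤-<-trans h≤y y<x) x≤m) b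
    ... | here refl = ⊥-elim (ℕP.<-irrefl refl y<x)
    ... | there x∈R = x∈R
    backward : x ∈ R → bad x ≡ true
    backward x∈R = proj₂ (ab x (ℕP.≤-<-trans h≤y y<x) x≤m) (there x∈R)

  Above-end : ∀ h ts {R} → Above h (after h ts ++ R) → Above (end h ts) R
  Above-end h []       ab = ab
  Above-end h (t ∷ ts) ab = Above-end (up t h) ts (Above-drop (up-≥ t h) ab)

  not-bad : ∀ {h R k} → Above h R → All (k ℕ.≤_) R → ∀ x → h ℕ.< x → x ℕ.< k → x ℕ.≤ m → bad x ≡ false
  not-bad ab R≥k x h<x x<k x≤m with bad x in b
  ... | false = refl
  ... | true  = ⊥-elim (ℕP.<⇒≱ x<k (All.lookup R≥k (proj₁ (ab x h<x x≤m) b)))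

  gap : ∀ k h {e} → (∀ x → h ℕ.< x → x ℕ.≤ k ℕ.+ h → bad x ≡ false) → Climb (k ℕ.+ h) e → Climb h e
  gap zero    h     free c = c
  gap (suc k) h {e} free c = good (free (suc h) ℕP.≤-refl (s≤s (ℕP.m≤n+m h k)))
    (gap k (suc h) (λ x h<x x≤ → free x (ℕP.<-trans (ℕP.n<1+n h) h<x) (ℕP.≤-trans x≤ (ℕP.≤-reflexive (ℕP.+-suc k h))))
      (subst (λ z → Climb z e) (sym (ℕP.+-suc k h)) c))

  gap-≤ : ∀ {h a e} → h ℕ.≤ a → (∀ x → h ℕ.< x → x ℕ.≤ a → bad x ≡ false) → Climb a e → Climb h e
  gap-≤ {h} {a} {e} h≤a free c = gap (a ℕ.∸ h) h
    (λ x h<x x≤ → free x h<x (ℕP.≤-trans x≤ (ℕP.≤-reflexive (ℕP.m∸n+n≡m h≤a))))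
    (subst (λ z → Climb z e) (sym (ℕP.m∸n+n≡m h≤a)) c)

  -- The list has no element strictly between `h` and `up t h`, so all heights there are allowed. An
  -- entry 0 would repeat the height `h` and is excluded by positivity.
  mkBlock : ∀ {h ts R} → All (1 ℕ.≤_) ts → end h ts ℕ.≤ m → All (end h ts ℕ.<_) R →
    Above h (after h ts ++ R) → Block h ts (end h ts)
  mkBlock {ts = []} _ _ _ _ = done
  mkBlock {h} {suc t ∷ ts} {R} (_ ∷ ts≥1) e≤m R>e ab = go t h e≤m R>e ab
    where
    go : ∀ t h → end h (suc t ∷ ts) ℕ.≤ m → All (end h (suc t ∷ ts) ℕ.<_) R →
      Above h (after h (suc t ∷ ts) ++ R) → Block h (suc t ∷ ts) (end h (suc t ∷ ts))
    go zero h e≤m R>e ab = next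
      (not-bad ab (ℕP.≤-refl ∷ ++⁺ (after-≥ (suc (suc h)) ts) (All.map (λ e<x → ℕP.≤-trans (end-≥ (suc (suc h)) ts) (ℕP.<⇒≤ e<x)) R>e))
        (suc h) ℕP.≤-refl ℕP.≤-refl (ℕP.≤-trans (ℕP.n≤1+n (suc h)) 2+h≤m))
      (proj₂ (ab (suc (suc h)) (ℕP.n≤1+n (suc h)) 2+h≤m) (here refl))
      (mkBlock ts≥1 e≤m R>e (Above-drop (ℕP.≤-trans (ℕP.n≤1+n h) (ℕP.n≤1+n (suc h))) ab))
      where
      2+h≤m : suc (suc h) ℕ.≤ m
      2+h≤m = ℕP.≤-trans (end-≥ (suc (suc h)) ts) e≤m
    go (suc t) h e≤m R>e ab = good
      (free (suc h) ℕP.≤-refl (ℕP.n≤1+n (suc (suc h))))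
      (free (suc (suc h)) (ℕP.n≤1+n (suc h)) ℕP.≤-refl)
      (go t (suc (suc h)) e≤m R>e (Above-mono (ℕP.≤-trans (ℕP.n≤1+n h) (ℕP.n≤1+n (suc h))) ab))
      where
      y : ℕ
      y = up (suc t) (suc (suc h))
      3+h≤y : suc (suc (suc h)) ℕ.≤ y
      3+h≤y = ℕP.≤-trans (ℕP.n≤1+n _) (up-≥ t (suc (suc (suc (suc h)))))
      all≥ : All (y ℕ.≤_) (y ∷ after y ts ++ R)
      all≥ = ℕP.≤-refl ∷ ++⁺ (after-≥ y ts) (All.map (λ e<x → ℕP.≤-trans (end-≥ y ts) (ℕP.<⇒≤ e<x)) R>e)
      free : ∀ x → h ℕ.< x → x ℕ.< suc (suc (suc h)) → bad x ≡ false
      free x h<x x< = not-bad ab all≥ x h<x (ℕP.≤-trans x< 3+h≤y)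
        (ℕP.≤-trans (ℕP.<⇒≤ (ℕP.≤-trans x< 3+h≤y)) (ℕP.≤-trans (end-≥ y ts) e≤m))

  Primitive⇒positive : ∀ {ts} → Primitive ts → All (1 ℕ.≤_) ts
  Primitive⇒positive (prim pos _) = pos

  Layout⇒Climb : ∀ {h R} → Layout m h R → Above h R → Climb h m
  -- Every bound holds for the empty list, so `suc x` can be chosen to lie above `x`.
  Layout⇒Climb (nil h≤m) ab = gap-≤ h≤m (λ x h<x x≤m → not-bad {k = suc x} ab [] x h<x ℕP.≤-refl x≤m) here
  Layout⇒Climb (cons {h} {a} {ts} {R} h≤a isPrim e≤m L′) ab =
    gap-≤ h≤a (λ x h<x x≤a → not-bad ab all≥ x h<x (s≤s x≤a) (ℕP.≤-trans x≤a (ℕP.<⇒≤ a<m)))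
      (block (proj₂ (ab (suc a) (s≤s h≤a) a<m) (here refl)) isPrim
        (mkBlock (Primitive⇒positive isPrim) e≤m (Layout-> L′) ab′)
        (Layout⇒Climb L′ (Above-end (suc a) ts ab′)))
    where
    a<m : a ℕ.< m
    a<m = ℕP.≤-trans (end-≥ (suc a) ts) e≤m
    all≥ : All (suc a ℕ.≤_) (suc a ∷ after (suc a) ts ++ R)
    all≥ = ℕP.≤-refl ∷ ++⁺ (after-≥ (suc a) ts)
      (All.map (λ e<x → ℕP.≤-trans (end-≥ (suc a) ts) (ℕP.<⇒≤ e<x)) (Layout-> L′))
    ab′ : Above (suc a) (after (suc a) ts ++ R)
    ab′ = Above-drop (ℕP.≤-trans h≤a (ℕP.n≤1+n a)) ab

-- From the shifted sets to a layout

up-ℤ : ∀ t h → + up t h ≡ + 2 * + t + + h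
up-ℤ zero    h = sym (+-identityˡ (+ h))
up-ℤ (suc t) h = trans (up-ℤ t (suc (suc h))) (regroup (+ t) (+ h))
  where
  regroup : ∀ t h → + 2 * t + (+ 1 + (+ 1 + h)) ≡ + 2 * (+ 1 + t) + h
  regroup = solve-∀

-- An arbitrary partial sum `s` makes the induction along `scanl` possible.
shift-scanl : ∀ k ts s h → + h ≡ + (2 ℕ.* (1 ℕ.+ s)) + k →
  shift k (map (λ s → 2 ℕ.* (1 ℕ.+ s)) (scanl ℕ._+_ s ts)) ≡ map +_ (h ∷ after h ts)
shift-scanl k []       s h e = cong (_∷ []) (sym e)
shift-scanl k (t ∷ ts) s h e = cong₂ _∷_ (sym e) (shift-scanl k ts (s ℕ.+ t) (up t h) (begin
  + up t h
    ≡⟨ up-ℤ t h ⟩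
  + 2 * + t + + h
    ≡⟨ cong (λ z → + 2 * + t + z) (trans e (cong (_+ k) (ℤP.pos-* 2 (1 ℕ.+ s)))) ⟩
  + 2 * + t + (+ 2 * (+ 1 + + s) + k)
    ≡⟨ regroup (+ t) (+ s) k ⟩
  + 2 * (+ 1 + (+ s + + t)) + k
    ≡⟨ cong (_+ k) (ℤP.pos-* 2 (1 ℕ.+ (s ℕ.+ t))) ⟨
  + (2 ℕ.* (1 ℕ.+ (s ℕ.+ t))) + k ∎))
  where
  regroup : ∀ t s k → + 2 * t + (+ 2 * (+ 1 + s) + k) ≡ + 2 * (+ 1 + (s + t)) + k
  regroup = solve-∀

shift-Vset : ∀ {k a} ts → k + + 1 ≡ + a → shift k (Vset ts) ≡ map +_ (suc a ∷ after (suc a) ts)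
shift-Vset {k} {a} ts e = shift-scanl k ts 0 (suc a) (trans (cong (λ z → + 1 + z) (sym e)) (regroup k))
  where
  regroup : ∀ k → + 1 + (k + + 1) ≡ + 2 + k
  regroup = solve-∀

bigV-suc : ∀ b αs ks → bigV (suc b) αs ks ≡
  shift (ks zero) (Vset (αs zero)) ++ bigV b (λ j → αs (suc j)) (λ j → ks (suc j))
bigV-suc b αs ks = cong (λ L → shift (ks zero) (Vset (αs zero)) ++ concat L)
  (trans (map-tabulate {n = b} suc f) (sym (map-tabulate {n = b} (λ j → j) (λ j → f (suc j)))))
  where
  f : Fin (suc b) → List ℤ
  f j = shift (ks j) (Vset (αs j))

+≤⇒ℕ : ∀ {h i} → + h ℤ.≤ i → Σ ℕ λ a → (i ≡ + a) × (h ℕ.≤ a)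
+≤⇒ℕ (ℤ.+≤+ {n = a} h≤a) = a , refl , h≤a

Arranged : ℕ → ℕ → List ℤ → Set
Arranged m h V = Σ (List ℕ) λ R → (V ≡ map +_ R) × Layout m h R

arrange-block : ∀ {m h a ts k V} → h ℕ.≤ a → k + + 1 ≡ + a → Primitive ts → end (suc a) ts ℕ.≤ m →
  Arranged m (end (suc a) ts) V → Arranged m h (shift k (Vset ts) ++ V)
arrange-block {a = a} {ts} {k} h≤a ka isPrim e≤m (R , V≡ , L) =
  suc a ∷ after (suc a) ts ++ R ,
  trans (cong₂ _++_ (shift-Vset {k} ts ka) V≡) (sym (map-++ +_ (suc a ∷ after (suc a) ts) R)) ,
  cons h≤a isPrim e≤m L

All-shift⇒end : ∀ {P : ℤ → Set} {k a} ts → k + + 1 ≡ + a → All P (shift k (Vset ts)) → P (+ end (suc a) ts)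
All-shift⇒end {P} {k} {a} ts ka ps =
  All.lookup (subst (All P) (shift-Vset {k} ts ka) ps) (∈-map⁺ +_ (end-∈ (suc a) ts))

-- The blocks are placed in order, `h` being the last height used so far. That height belongs to the
-- set of the previous block, so the chain condition supplies the bound for the next call.
arrange : ∀ b αs → (∀ j → Primitive (αs j)) → ∀ ks h → + h ℤ.≤ ks zero + + 1 →
  ((j : Fin b) → All (λ v → v ℤ.≤ ks (suc j) + + 1) (shift (ks (inject₁ j)) (Vset (αs (inject₁ j))))) →
  ∀ m → All (λ v → v ℤ.≤ + m) (bigV (suc b) αs ks) → Arranged m h (bigV (suc b) αs ks)
arrange b αs isPrims ks h h≤k chain m V≤m with +≤⇒ℕ h≤k
... | a , ka , h≤a = subst (Arranged m h) (sym (bigV-suc b αs ks))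
    (arrange-block {k = ks zero} h≤a ka (isPrims zero) e≤m (rest b αs isPrims ks chain ka (AllP.++⁻ʳ (shift (ks zero) (Vset (αs zero))) V≤m′) e≤m))
  where
  V≤m′ : All (λ v → v ℤ.≤ + m) (shift (ks zero) (Vset (αs zero)) ++ bigV b (λ j → αs (suc j)) (λ j → ks (suc j)))
  V≤m′ = subst (All (λ v → v ℤ.≤ + m)) (bigV-suc b αs ks) V≤m
  e≤m : end (suc a) (αs zero) ℕ.≤ m
  e≤m = ℤP.drop‿+≤+ (All-shift⇒end {λ v → v ℤ.≤ + m} {ks zero} (αs zero) ka (AllP.++⁻ˡ (shift (ks zero) (Vset (αs zero))) V≤m′))
  rest : ∀ b (αs : Fin (suc b) → List ℕ) → (∀ j → Primitive (αs j)) → (ks : Fin (suc b) → ℤ) →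
    ((j : Fin b) → All (λ v → v ℤ.≤ ks (suc j) + + 1) (shift (ks (inject₁ j)) (Vset (αs (inject₁ j))))) →
    ks zero + + 1 ≡ + a → All (λ v → v ℤ.≤ + m) (bigV b (λ j → αs (suc j)) (λ j → ks (suc j))) →
    end (suc a) (αs zero) ℕ.≤ m → Arranged m (end (suc a) (αs zero)) (bigV b (λ j → αs (suc j)) (λ j → ks (suc j)))
  rest zero    αs isPrims ks chain ka V≤m e≤m = [] , refl , nil e≤m
  rest (suc b) αs isPrims ks chain ka V≤m e≤m =
    arrange b (λ j → αs (suc j)) (λ j → isPrims (suc j)) (λ j → ks (suc j)) (end (suc a) (αs zero))
      (All-shift⇒end {λ v → v ℤ.≤ ks (suc zero) + + 1} {ks zero} (αs zero) ka (chain zero)) (λ j → chain (suc j)) m V≤m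

-- Periodicity for the series of restricted Dyck paths

theorem1p6 : (b′ : ℕ) (αs : Fin (suc b′) → List ℕ) →
    ((j : Fin (suc b′)) → Primitive (αs j)) →
    (ks : Fin (suc b′) → ℤ) →
    -[1+ 0 ] ℤ.≤ ks zero →
    ((j : Fin b′) → All (λ v → v ℤ.≤ ks (suc j) ℤ.+ + 1)
    (shift (ks (inject₁ j)) (Vset (αs (inject₁ j))))) →
    (m : ℕ) → 2 ℕ.≤ m →
    All (λ v → v ℤ.≤ + m) (bigV (suc b′) αs ks) →
    Periodic (hankel (λ n → + dyckCount m (bigV (suc b′) αs ks) n))
theorem1p6 b′ αs isPrims ks -1≤k chain m 2≤m V≤m
  with arrange b′ αs isPrims ks 0 (ℤP.+-monoˡ-≤ (+ 1) -1≤k) chain m V≤m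
-- Four rounds of `m` levels lower the index of `S` by `4 m`, which is `2 m` in the size of the
-- determinant.
... | R , V≡ , L = m ℕ.+ m , ℕP.≤-trans (ℕP.<⇒≤ 2≤m) (ℕP.m≤m+n m m) , λ n _ → begin
    H (n ℕ.+ (m ℕ.+ m))
      ≡⟨ cong H (ℕP.+-comm n (m ℕ.+ m)) ⟩
    H (m ℕ.+ m ℕ.+ n)
      ≡⟨ hankel-cong (m ℕ.+ m ℕ.+ n) (dyckCount≡dyckSeries m V) ⟩
    hankel (levelSeries bad 0) (m ℕ.+ m ℕ.+ n)
      ≡⟨ hankel-periodic m (dyckSeries-cong (inMV-periodic m V)) (Layout⇒Climb L above) n ⟩
    hankel (levelSeries bad 0) n
      ≡⟨ hankel-cong n (dyckCount≡dyckSeries m V) ⟨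
    H n ∎
  where
  V : List ℤ
  V = bigV (suc b′) αs ks
  bad : ℕ → Bool
  bad = inMV m V
  H : ℕ → ℤ
  H = hankel (λ n → + dyckCount m V n)
  open Levels bad (levelSeries bad) (levelSeries-unfold bad)
  open Climbing m bad
  above : Above 0 R
  above x 0<x x≤m =
    (λ b → inMV⇒∈ (Layout-> L) (Layout-≤ L) 0<x x≤m (trans (cong (λ W → inMV m W x) (sym V≡)) b)) ,
    (λ x∈R → trans (cong (λ W → inMV m W x) V≡) (∈⇒inMV m x∈R))
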